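{- For every integer $t$, there exists a connected non-bipartite graph whose adjacency matrix has exactly four distinct eigenvalues and which has at least $t$ distinct valencies.
   Context: Graphs are finite, simple and undirected; eigenvalues of a graph are those of its adjacency matrix; valencies are vertex degrees. -}

module Defs where

open import Algebra.Bundles.Raw using (RawRing)
import Algebra.Definitions.RawMonoid as RawMonoidDefinitions
open import Data.Bool.Base using (Bool; if_then_else_)
open import Data.Fin.Base using (Fin)
open import Data.List.Base using (List; allFin; deduplicate; filter; length; map)
open import Data.Nat.Base as ℕ using (ℕ; _⊔_)
import Data.Nat.Properties as ℕ
open import Data.Product.Base using (_×_; _,_; Σ-syntax; ∃-syntax)
open import Data.Rational.Base as ℚ using (ℚ; 0ℚ; 1ℚ)
import Data.Rational.Properties as ℚ
open import Data.Rational.Solver using (module +-*-Solver)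
open import Data.Vec.Functional using (Vector)
open import Level using (0ℓ)
open import Relation.Binary.Core using (Rel)
open import Relation.Binary.Definitions using (Decidable; Irreflexive; Symmetric)
open import Relation.Binary.Construct.Closure.ReflexiveTransitive using (Star)
open import Relation.Binary.PropositionalEquality
  using (_≡_; _≢_; refl; sym; trans; cong; cong₂; subst)
open import Relation.Nullary.Decidable using (does)

-- Reals are Cauchy sequences of rationals, up to _≈_; apartness _#_ is
-- the constructively positive form of "distinct".

Eventually : (ℕ → Set) → Set
Eventually P = ∃[ N ] (∀ n → N ℕ.≤ n → P n)

Cauchy : (ℕ → ℚ) → Set
Cauchy f = ∀ ε → 0ℚ ℚ.< ε →
  ∃[ N ] (∀ m n → N ℕ.≤ m → N ℕ.≤ n → ℚ.∣ f m ℚ.- f n ∣ ℚ.< ε)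

record ℝ : Set where
  constructor mkℝ
  field
    seq    : ℕ → ℚ
    cauchy : Cauchy seq

open ℝ public

infix 4 _≈_ _#_

_≈_ : Rel ℝ 0ℓ
x ≈ y = ∀ ε → 0ℚ ℚ.< ε →
  Eventually (λ n → ℚ.∣ seq x n ℚ.- seq y n ∣ ℚ.< ε)

_#_ : Rel ℝ 0ℓ
x # y = ∃[ ε ] (0ℚ ℚ.< ε ×
  Eventually (λ n → ε ℚ.≤ ℚ.∣ seq x n ℚ.- seq y n ∣))

private
  module RationalIdentities where
    open +-*-Solver

    insert : ∀ a b → a ≡ (a ℚ.- b) ℚ.+ b
    insert = solve 2 (λ a b → a := (a :- b) :+ b) refl

    +-difference : ∀ a b c d →
      (a ℚ.+ b) ℚ.- (c ℚ.+ d) ≡ (a ℚ.- c) ℚ.+ (b ℚ.- d)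
    +-difference = solve 4 (λ a b c d →
      (a :+ b) :- (c :+ d) := (a :- c) :+ (b :- d)) refl

    *-difference : ∀ a b c d →
      a ℚ.* b ℚ.- c ℚ.* d ≡ a ℚ.* (b ℚ.- d) ℚ.+ d ℚ.* (a ℚ.- c)
    *-difference = solve 4 (λ a b c d →
      a :* b :- c :* d := a :* (b :- d) :+ d :* (a :- c)) refl

  open RationalIdentities

  ∣p-p∣≡0 : ∀ p → ℚ.∣ p ℚ.- p ∣ ≡ 0ℚ
  ∣p-p∣≡0 p = cong ℚ.∣_∣ (ℚ.+-inverseʳ p)

  split : ∀ B C ε → 0ℚ ℚ.< B → 0ℚ ℚ.< C → 0ℚ ℚ.< ε →
          ∃[ δ ] (0ℚ ℚ.< δ × B ℚ.* δ ℚ.+ C ℚ.* δ ≡ ε)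
  split B C ε 0<B 0<C 0<ε = δ , ℚ.positive⁻¹ δ , eq
    where
    instance
      _ = ℚ.positive 0<B
      _ = ℚ.positive 0<C
      _ = ℚ.positive 0<ε
      B+C>0 = ℚ.pos+pos⇒pos B C
      B+C≢0 = ℚ.pos⇒nonZero (B ℚ.+ C)
      1/>0  = ℚ.1/pos⇒pos (B ℚ.+ C)
    δ : ℚ
    δ = ℚ.1/ (B ℚ.+ C) ℚ.* ε
    instance
      δ>0 = ℚ.pos*pos⇒pos (ℚ.1/ (B ℚ.+ C)) ε
    eq : B ℚ.* δ ℚ.+ C ℚ.* δ ≡ ε
    eq = trans (sym (ℚ.*-distribʳ-+ δ B C))
        (trans (sym (ℚ.*-assoc (B ℚ.+ C) (ℚ.1/ (B ℚ.+ C)) ε))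
        (trans (cong (ℚ._* ε) (ℚ.*-inverseʳ (B ℚ.+ C))) (ℚ.*-identityˡ ε)))

  0<1 : 0ℚ ℚ.< 1ℚ
  0<1 = ℚ.positive⁻¹ 1ℚ

  bounded : ∀ f → Cauchy f →
            ∃[ B ] (0ℚ ℚ.< B × Eventually (λ n → ℚ.∣ f n ∣ ℚ.≤ B))
  bounded f cf with cf 1ℚ 0<1
  ... | N , h = 1ℚ ℚ.+ ℚ.∣ f N ∣
              , ℚ.+-mono-<-≤ 0<1 (ℚ.0≤∣p∣ (f N))
              , N , bound
    where
    open ℚ.≤-Reasoning
    bound : ∀ n → N ℕ.≤ n → ℚ.∣ f n ∣ ℚ.≤ 1ℚ ℚ.+ ℚ.∣ f N ∣
    bound n N≤n = begin
      ℚ.∣ f n ∣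
        ≡⟨ cong ℚ.∣_∣ (insert (f n) (f N)) ⟩
      ℚ.∣ (f n ℚ.- f N) ℚ.+ f N ∣
        ≤⟨ ℚ.∣p+q∣≤∣p∣+∣q∣ (f n ℚ.- f N) (f N) ⟩
      ℚ.∣ f n ℚ.- f N ∣ ℚ.+ ℚ.∣ f N ∣
        ≤⟨ ℚ.+-monoˡ-≤ ℚ.∣ f N ∣ (ℚ.<⇒≤ (h n N N≤n ℕ.≤-refl)) ⟩
      1ℚ ℚ.+ ℚ.∣ f N ∣ ∎

  abstract
    cauchy-const : ∀ p → Cauchy (λ _ → p)
    cauchy-const p ε 0<ε = 0 , λ _ _ _ _ → subst (ℚ._< ε) (sym (∣p-p∣≡0 p)) 0<ε

    cauchy-neg : ∀ f → Cauchy f → Cauchy (λ n → ℚ.- f n)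
    cauchy-neg f cf ε 0<ε with cf ε 0<ε
    ... | N , h = N , λ m n N≤m N≤n →
      subst (ℚ._< ε)
        (trans (sym (ℚ.∣-p∣≡∣p∣ (f m ℚ.- f n)))
               (cong ℚ.∣_∣ (ℚ.neg-distrib-+ (f m) (ℚ.- f n))))
        (h m n N≤m N≤n)

    cauchy-+ : ∀ f g → Cauchy f → Cauchy g → Cauchy (λ n → f n ℚ.+ g n)
    cauchy-+ f g cf cg ε 0<ε with split 1ℚ 1ℚ ε 0<1 0<1 0<ε
    ... | δ , 0<δ , δ+δ≡ε with cf δ 0<δ | cg δ 0<δ
    ... | M , hf | N , hg = M ⊔ N , close
      where
      open ℚ.≤-Reasoning
      close : ∀ m n → M ⊔ N ℕ.≤ m → M ⊔ N ℕ.≤ n →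
              ℚ.∣ (f m ℚ.+ g m) ℚ.- (f n ℚ.+ g n) ∣ ℚ.< ε
      close m n ≤m ≤n = begin-strict
        ℚ.∣ (f m ℚ.+ g m) ℚ.- (f n ℚ.+ g n) ∣
          ≡⟨ cong ℚ.∣_∣ (+-difference (f m) (g m) (f n) (g n)) ⟩
        ℚ.∣ (f m ℚ.- f n) ℚ.+ (g m ℚ.- g n) ∣
          ≤⟨ ℚ.∣p+q∣≤∣p∣+∣q∣ (f m ℚ.- f n) (g m ℚ.- g n) ⟩
        ℚ.∣ f m ℚ.- f n ∣ ℚ.+ ℚ.∣ g m ℚ.- g n ∣
          <⟨ ℚ.+-mono-< (hf m n (ℕ.m⊔n≤o⇒m≤o M N ≤m) (ℕ.m⊔n≤o⇒m≤o M N ≤n))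
                        (hg m n (ℕ.m⊔n≤o⇒n≤o M N ≤m) (ℕ.m⊔n≤o⇒n≤o M N ≤n)) ⟩
        δ ℚ.+ δ
          ≡⟨ cong₂ ℚ._+_ (sym (ℚ.*-identityˡ δ)) (sym (ℚ.*-identityˡ δ)) ⟩
        1ℚ ℚ.* δ ℚ.+ 1ℚ ℚ.* δ
          ≡⟨ δ+δ≡ε ⟩
        ε ∎

    ∣*∣-bound : ∀ {p q B δ} → 0ℚ ℚ.< B → ℚ.∣ p ∣ ℚ.≤ B → ℚ.∣ q ∣ ℚ.< δ →
                ℚ.∣ p ℚ.* q ∣ ℚ.< B ℚ.* δ
    ∣*∣-bound {p} {q} {B} {δ} 0<B p≤B q<δ = begin-strict
      ℚ.∣ p ℚ.* q ∣         ≡⟨ ℚ.∣p*q∣≡∣p∣*∣q∣ p q ⟩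
      ℚ.∣ p ∣ ℚ.* ℚ.∣ q ∣   ≤⟨ ℚ.*-monoʳ-≤-nonNeg ℚ.∣ q ∣ p≤B ⟩
      B ℚ.* ℚ.∣ q ∣         <⟨ ℚ.*-monoʳ-<-pos B q<δ ⟩
      B ℚ.* δ               ∎
      where
      open ℚ.≤-Reasoning
      instance
        B-pos : ℚ.Positive B
        B-pos = ℚ.positive 0<B
        ∣q∣-nonNeg : ℚ.NonNegative ℚ.∣ q ∣
        ∣q∣-nonNeg = ℚ.∣-∣-nonNeg q

    *-close : ∀ a b c d {B C δ} → 0ℚ ℚ.< B → 0ℚ ℚ.< C →
              ℚ.∣ a ∣ ℚ.≤ B → ℚ.∣ d ∣ ℚ.≤ C →
              ℚ.∣ a ℚ.- c ∣ ℚ.< δ → ℚ.∣ b ℚ.- d ∣ ℚ.< δ →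
              ℚ.∣ a ℚ.* b ℚ.- c ℚ.* d ∣ ℚ.< B ℚ.* δ ℚ.+ C ℚ.* δ
    *-close a b c d {B} {C} {δ} 0<B 0<C a≤B d≤C a-c<δ b-d<δ = begin-strict
      ℚ.∣ a ℚ.* b ℚ.- c ℚ.* d ∣
        ≡⟨ cong ℚ.∣_∣ (*-difference a b c d) ⟩
      ℚ.∣ a ℚ.* (b ℚ.- d) ℚ.+ d ℚ.* (a ℚ.- c) ∣
        ≤⟨ ℚ.∣p+q∣≤∣p∣+∣q∣ (a ℚ.* (b ℚ.- d)) (d ℚ.* (a ℚ.- c)) ⟩
      ℚ.∣ a ℚ.* (b ℚ.- d) ∣ ℚ.+ ℚ.∣ d ℚ.* (a ℚ.- c) ∣
        <⟨ ℚ.+-mono-< (∣*∣-bound {a} {b ℚ.- d} 0<B a≤B b-d<δ)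
                      (∣*∣-bound {d} {a ℚ.- c} 0<C d≤C a-c<δ) ⟩
      B ℚ.* δ ℚ.+ C ℚ.* δ ∎
      where open ℚ.≤-Reasoning

    cauchy-* : ∀ f g → Cauchy f → Cauchy g → Cauchy (λ n → f n ℚ.* g n)
    cauchy-* f g cf cg ε 0<ε =
      let B , 0<B , K , f≤B = bounded f cf
          C , 0<C , L , g≤C = bounded g cg
          δ , 0<δ , eq      = split B C ε 0<B 0<C 0<ε
          M , hf            = cf δ 0<δ
          N , hg            = cg δ 0<δ
      in (K ⊔ L) ⊔ (M ⊔ N) , λ m n ≤m ≤n →
        let KL≤m = ℕ.m⊔n≤o⇒m≤o (K ⊔ L) (M ⊔ N) ≤m
            MN≤m = ℕ.m⊔n≤o⇒n≤o (K ⊔ L) (M ⊔ N) ≤m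
            KL≤n = ℕ.m⊔n≤o⇒m≤o (K ⊔ L) (M ⊔ N) ≤n
            MN≤n = ℕ.m⊔n≤o⇒n≤o (K ⊔ L) (M ⊔ N) ≤n
        in subst (ℚ.∣ f m ℚ.* g m ℚ.- f n ℚ.* g n ∣ ℚ.<_) eq
             (*-close (f m) (g m) (f n) (g n) 0<B 0<C
               (f≤B m (ℕ.m⊔n≤o⇒m≤o K L KL≤m))
               (g≤C n (ℕ.m⊔n≤o⇒n≤o K L KL≤n))
               (hf m n (ℕ.m⊔n≤o⇒m≤o M N MN≤m) (ℕ.m⊔n≤o⇒m≤o M N MN≤n))
               (hg m n (ℕ.m⊔n≤o⇒n≤o M N MN≤m) (ℕ.m⊔n≤o⇒n≤o M N MN≤n)))

fromℚ : ℚ → ℝ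
fromℚ p = mkℝ (λ _ → p) (cauchy-const p)

infix  8 -_
infixl 7 _*_
infixl 6 _+_

_+_ : ℝ → ℝ → ℝ
x + y = mkℝ (λ n → seq x n ℚ.+ seq y n) (cauchy-+ (seq x) (seq y) (cauchy x) (cauchy y))

_*_ : ℝ → ℝ → ℝ
x * y = mkℝ (λ n → seq x n ℚ.* seq y n) (cauchy-* (seq x) (seq y) (cauchy x) (cauchy y))

-_ : ℝ → ℝ
- x = mkℝ (λ n → ℚ.- seq x n) (cauchy-neg (seq x) (cauchy x))

0ℝ 1ℝ : ℝ
0ℝ = fromℚ 0ℚ
1ℝ = fromℚ 1ℚ

ℝ-rawRing : RawRing 0ℓ 0ℓ
ℝ-rawRing = record
  { Carrier = ℝ ; _≈_ = _≈_ ; _+_ = _+_ ; _*_ = _*_ ; -_ = -_ ; 0# = 0ℝ ; 1# = 1ℝ }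

open RawMonoidDefinitions (RawRing.+-rawMonoid ℝ-rawRing) public using (sum)

Matrix : ℕ → Set
Matrix n = Fin n → Fin n → ℝ

infixr 7 _*ᵥ_

_*ᵥ_ : ∀ {n} → Matrix n → Vector ℝ n → Vector ℝ n
(A *ᵥ v) i = sum (λ j → A i j * v j)

-- A real symmetric matrix has only real eigenvalues, so for adjacency
-- matrices nothing is lost by taking x and v real.
IsEigenvalue : ∀ {n} → Matrix n → ℝ → Set
IsEigenvalue {n} A x = Σ[ v ∈ Vector ℝ n ]
  ((∃[ i ] v i # 0ℝ) × (∀ i → (A *ᵥ v) i ≈ x * v i))

HasExactlyDistinctEigenvalues : ∀ {n} → ℕ → Matrix n → Set
HasExactlyDistinctEigenvalues k A = Σ[ θ ∈ Vector ℝ k ]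
  ( (∀ i j → i ≢ j → θ i # θ j)
  × (∀ i → IsEigenvalue A (θ i))
  × (∀ x → IsEigenvalue A x → ∃[ i ] x ≈ θ i))

record Graph : Set₁ where
  infix 4 _~_ _~?_
  field
    order    : ℕ
    _~_      : Rel (Fin order) 0ℓ
    _~?_     : Decidable _~_
    ~-sym    : Symmetric _~_
    ~-irrefl : Irreflexive _≡_ _~_

  Vertex : Set
  Vertex = Fin order

  adjacencyMatrix : Matrix order
  adjacencyMatrix i j = if does (i ~? j) then 1ℝ else 0ℝ

  valency : Vertex → ℕ
  valency i = length (filter (i ~?_) (allFin order))

  distinctValencies : List ℕ
  distinctValencies = deduplicate ℕ._≟_ (map valency (allFin order))

  -- The graph with no vertices is not counted as connected.
  Connected : Set
  Connected = order ≢ 0 × (∀ i j → Star _~_ i j)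

  Bipartite : Set
  Bipartite = Σ[ side ∈ (Vertex → Bool) ] (∀ {i j} → i ~ j → side i ≢ side j)

{-# OPTIONS --safe #-}
module Submission where

open import Algebra.Bundles using (CommutativeMonoid; CommutativeRing)
import Algebra.Properties.AbelianGroup
import Algebra.Properties.CommutativeMonoid.Sum
import Algebra.Properties.Semiring.Sum
import Algebra.Solver.Ring.NaturalCoefficients.Default as SemiringSolver
open import Data.Bool.Base using (if_then_else_; true; false)
import Data.Bool.Properties as Bool
open import Data.Fin.Base as Fin
  using (Fin; zero; suc; toℕ; _↑ˡ_; _↑ʳ_; combine; quotient; remainder; punchIn)
open import Data.Fin.Patterns using (0F; 1F; 2F; 3F; 4F; 7F)
import Data.Fin.Properties as Fin
open import Data.Integer.Base as ℤ using (ℤ; +_; _≤_; 0ℤ; 1ℤ; -1ℤ; _◃_)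
import Data.Integer.Properties as ℤ
open import Data.Integer.Solver using () renaming (module +-*-Solver to ℤ-Solver)
open import Data.List.Base as List using (List; []; _∷_; length; filter; tabulate)
open import Data.List.Membership.Propositional using (_∈_)
open import Data.List.Membership.Propositional.Properties
  using (∈-allFin; ∈-deduplicate⁺; ∈-lookup; ∈-map⁺)
open import Data.List.Relation.Unary.All as All using (All; []; _∷_)
open import Data.List.Relation.Unary.AllPairs using ([]; _∷_)
open import Data.List.Relation.Unary.Any as Any using (Any; here; there)
import Data.List.Relation.Unary.Any.Properties as Any
open import Data.List.Relation.Unary.Unique.Propositional using (Unique)
import Data.List.Relation.Unary.Unique.Propositional.Properties as Unique
open import Data.Nat.Base as ℕ using (ℕ; zero; suc; _⊔_)
import Data.Nat.Properties as ℕ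
open import Data.Nat.Solver using () renaming (module +-*-Solver to ℕ-Solver)
open import Data.Product.Base using (_×_; _,_; proj₁; proj₂; Σ-syntax; ∃-syntax)
open import Data.Rational.Base as ℚ using (ℚ; 0ℚ; 1ℚ; ½)
open import Data.Rational.Literals using (fromℤ)
import Data.Rational.Properties as ℚ
open import Data.Rational.Solver using () renaming (module +-*-Solver to ℚ-Solver)
import Data.Rational.Unnormalised.Base as ℚᵘ
import Data.Rational.Unnormalised.Properties as ℚᵘ
open import Data.Sign.Base as Sign using (Sign)
import Data.Sign.Properties as Sign
open import Data.Sum.Base using (_⊎_; inj₁; inj₂; [_,_]′)
open import Data.Vec.Functional using (Vector; removeAt)
open import Function.Base using (_∘_; id)
open import Function.Definitions using (Injective)
open import Level using (0ℓ)
open import Relation.Binary.Construct.Closure.ReflexiveTransitive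
  using (Star; _◅_) renaming (ε to ε-walk)
open import Relation.Binary.PropositionalEquality as ≡
  using (_≡_; _≢_; _≗_; refl; sym; trans; cong; cong₂; subst; module ≡-Reasoning)
import Relation.Binary.Reasoning.Setoid
open import Relation.Nullary.Decidable
  using (Dec; yes; no; does; from-yes; ¬?; _×-dec_; _→-dec_; dec-true; dec-false)
open import Relation.Nullary.Negation.Core using (¬_; contradiction)
open import Relation.Unary using (Pred; Decidable)

-- Let K be a symmetric n × n matrix of signs with K² = n I, constant diagonal +
-- and sum of entries n = 4q² (a regular two-graph, suitably switched), and join
-- i to j when K i j is -; so A = (J - K) / 2. If A v = x v and σ = Σ v, h = K 1, then
-- (n - 4x²) v = σ (h - 2x 1) and, summing up, 2x (2x - n) σ = 0; hence every
-- eigenvalue is one of 0, n/2, ±q, with eigenvectors h, h - n 1 and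
-- K u ∓ 2q u for u = e_a - e_b with h_a = h_b. The number of common neighbours of i
-- and j is (n - h_i - h_j) / 4 > 0, which gives connectedness and triangles,
-- and the valency of i is (n - h_i) / 2. All hypotheses are inherited by Kronecker
-- products, and row sums multiply: a matrix of order 16 having both 4 and 8
-- among its row sums has a k-th Kronecker power with at least k + 1 valencies.

-- Finite sums in commutative monoids.

module MonoidSums {c ℓ} (M : CommutativeMonoid c ℓ) where
  open CommutativeMonoid M renaming (refl to ≈-refl; sym to ≈-sym; trans to ≈-trans)
  open Algebra.Properties.CommutativeMonoid.Sum M public
  open Relation.Binary.Reasoning.Setoid setoid

  sum-zero : ∀ {n} (f : Vector Carrier n) → (∀ i → f i ≈ ε) → sum f ≈ ε
  sum-zero {n} f f≈0 = ≈-trans (sum-cong-≋ f≈0) (sum-replicate-zero n)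

  sum-single : ∀ {n} (f : Vector Carrier n) i → (∀ j → j ≢ i → f j ≈ ε) → sum f ≈ f i
  sum-single {suc n} f i f≈0 = begin
    sum f                       ≈⟨ sum-remove {i = i} f ⟩
    f i ∙ sum (removeAt f i)    ≈⟨ ∙-congˡ (sum-zero _ λ j → f≈0 (punchIn i j) (Fin.punchInᵢ≢i i j)) ⟩
    f i ∙ ε                     ≈⟨ identityʳ _ ⟩
    f i                         ∎

  sum-++ : ∀ m {n} (f : Vector Carrier (m ℕ.+ n)) →
           sum f ≈ sum (f ∘ (_↑ˡ n)) ∙ sum (f ∘ (m ↑ʳ_))
  sum-++ zero    f = ≈-sym (identityˡ _)
  sum-++ (suc m) f = ≈-trans (∙-congˡ (sum-++ m (f ∘ suc))) (≈-sym (assoc _ _ _))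

  sum-combine : ∀ m {n} (f : Vector Carrier (m ℕ.* n)) →
                sum f ≈ sum {m} (λ i → sum {n} (λ j → f (combine i j)))
  sum-combine zero        f = ≈-refl
  sum-combine (suc m) {n} f = ≈-trans (sum-++ n f) (∙-congˡ (sum-combine m (f ∘ (n ↑ʳ_))))

open MonoidSums ℤ.+-0-commutativeMonoid using () renaming (sum to ∑)

-- Consequences of an eigenvector equation over a commutative ring.

module RingSums {c ℓ} (R : CommutativeRing c ℓ) where
  open CommutativeRing R hiding (zero) renaming (refl to ≈-refl; sym to ≈-sym; trans to ≈-trans)
  open MonoidSums +-commutativeMonoid public
  open Algebra.Properties.Semiring.Sum semiring public using (*-distribˡ-sum; *-distribʳ-sum)
  open Algebra.Properties.AbelianGroup +-abelianGroup using () renaming (∙-cancelˡ to +-cancelˡ)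
  open Relation.Binary.Reasoning.Setoid setoid
  open SemiringSolver commutativeSemiring using (solve; _:=_; _:*_; _:+_)

  -- The consequences of A v = x v for 2A = J - H with H² = N I are stated
  -- with both sides moved so that no subtraction occurs.
  module Eigenequation {n} (A H : Fin n → Fin n → Carrier) (N : Carrier)
    (2A+H≈1 : ∀ i j → A i j + A i j + H i j ≈ 1#)
    (square-diagonal : ∀ i → sum (λ k → H i k * H k i) ≈ N)
    (orthogonal : ∀ i j → i ≢ j → sum (λ k → H i k * H k j) ≈ 0#)
    (total : sum (λ i → sum (H i)) ≈ N)
    (ones : sum {n} (λ _ → 1#) ≈ N)
    (x : Carrier) (v : Vector Carrier n)
    (Av≈xv : ∀ i → sum (λ j → A i j * v j) ≈ x * v i) where

    σ 2x : Carrier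
    σ = sum v
    2x = x + x

    h Hv : Vector Carrier n
    h i = sum (H i)
    Hv i = sum (λ j → H i j * v j)

    -- A row of `J = 2 A + H` applied to `v`, where `A v = x v`.
    σ≈2xv+Hv : ∀ i → σ ≈ 2x * v i + Hv i
    σ≈2xv+Hv i = begin
      sum v
        ≈⟨ sum-cong-≋ (λ j → begin
             v j                                          ≈⟨ *-identityˡ (v j) ⟨
             1# * v j                                     ≈⟨ *-congʳ (2A+H≈1 i j) ⟨
             (A i j + A i j + H i j) * v j
               ≈⟨ solve 3 (λ a h v → (a :+ a :+ h) :* v := (a :* v :+ a :* v) :+ h :* v)
                    ≈-refl (A i j) (H i j) (v j) ⟩
             (A i j * v j + A i j * v j) + H i j * v j    ∎) ⟩
      sum (λ j → (A i j * v j + A i j * v j) + H i j * v j)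
        ≈⟨ ∑-distrib-+ (λ j → A i j * v j + A i j * v j) (λ j → H i j * v j) ⟩
      sum (λ j → A i j * v j + A i j * v j) + Hv i
        ≈⟨ +-congʳ (≈-trans (∑-distrib-+ (λ j → A i j * v j) (λ j → A i j * v j)) (+-cong (Av≈xv i) (Av≈xv i))) ⟩
      (x * v i + x * v i) + Hv i
        ≈⟨ +-congʳ (distribʳ (v i) x x) ⟨
      2x * v i + Hv i ∎

    HHv≈Nv : ∀ i → sum (λ j → H i j * Hv j) ≈ N * v i
    HHv≈Nv i = begin
      sum (λ j → H i j * Hv j)
        ≈⟨ sum-cong-≋ (λ j → ≈-trans (*-distribˡ-sum (H i j) (λ k → H j k * v k))
             (sum-cong-≋ (λ k → ≈-sym (*-assoc (H i j) (H j k) (v k))))) ⟩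
      sum (λ j → sum (λ k → H i j * H j k * v k))
        ≈⟨ ∑-comm (λ j k → H i j * H j k * v k) ⟩
      sum (λ k → sum (λ j → H i j * H j k * v k))
        ≈⟨ sum-cong-≋ (λ k → ≈-sym (*-distribʳ-sum (v k) (λ j → H i j * H j k))) ⟩
      sum (λ k → sum (λ j → H i j * H j k) * v k)
        ≈⟨ sum-single _ i (λ k k≢i → ≈-trans (*-congʳ (orthogonal i k (k≢i ∘ ≡.sym))) (zeroˡ (v k))) ⟩
      sum (λ j → H i j * H j i) * v i
        ≈⟨ *-congʳ (square-diagonal i) ⟩
      N * v i ∎

    -- Applying `H` to `σ 1 = 2x v + H v` gives `h σ = 2x H v + N v`; the same equation then
    -- eliminates `H v`.
    hσ+4x²v≈Nv+2xσ : ∀ i → h i * σ + 2x * 2x * v i ≈ N * v i + 2x * σ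
    hσ+4x²v≈Nv+2xσ i = begin
      h i * σ + 2x * 2x * v i
        ≈⟨ +-congʳ (begin
             h i * σ
               ≈⟨ *-distribʳ-sum σ (H i) ⟩
             sum (λ j → H i j * σ)
               ≈⟨ sum-cong-≋ (λ j → begin
                    H i j * σ                            ≈⟨ *-congˡ (σ≈2xv+Hv j) ⟩
                    H i j * (2x * v j + Hv j)
                      ≈⟨ solve 4 (λ h x v w → h :* (x :* v :+ w) := x :* (h :* v) :+ h :* w)
                           ≈-refl (H i j) 2x (v j) (Hv j) ⟩
                    2x * (H i j * v j) + H i j * Hv j    ∎) ⟩
             sum (λ j → 2x * (H i j * v j) + H i j * Hv j)
               ≈⟨ ∑-distrib-+ (λ j → 2x * (H i j * v j)) (λ j → H i j * Hv j) ⟩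
             sum (λ j → 2x * (H i j * v j)) + sum (λ j → H i j * Hv j)
               ≈⟨ +-cong (≈-sym (*-distribˡ-sum 2x (λ j → H i j * v j))) (HHv≈Nv i) ⟩
             2x * Hv i + N * v i ∎) ⟩
      2x * Hv i + N * v i + 2x * 2x * v i
        ≈⟨ solve 4 (λ x w N v → x :* w :+ N :* v :+ x :* x :* v := N :* v :+ x :* (x :* v :+ w))
             ≈-refl 2x (Hv i) N (v i) ⟩
      N * v i + 2x * (2x * v i + Hv i)
        ≈⟨ +-congˡ (*-congˡ (σ≈2xv+Hv i)) ⟨
      N * v i + 2x * σ ∎

    -- The previous equation is summed over `i`. By `total` the term `h σ` contributes `N σ`, which
    -- cancels against the sum of `N v`, and by `ones` the constant `2x σ` is counted `N` times.
    4x²σ≈2nxσ : 2x * 2x * σ ≈ N * (2x * σ)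
    4x²σ≈2nxσ = +-cancelˡ (N * σ) _ _ (begin
      N * σ + 2x * 2x * σ
        ≈⟨ +-cong (*-congʳ (≈-sym total)) (≈-refl {2x * 2x * σ}) ⟩
      sum h * σ + 2x * 2x * σ
        ≈⟨ +-cong (*-distribʳ-sum σ h) (*-distribˡ-sum (2x * 2x) v) ⟩
      sum (λ i → h i * σ) + sum (λ i → 2x * 2x * v i)
        ≈⟨ ∑-distrib-+ (λ i → h i * σ) (λ i → 2x * 2x * v i) ⟨
      sum (λ i → h i * σ + 2x * 2x * v i)
        ≈⟨ sum-cong-≋ hσ+4x²v≈Nv+2xσ ⟩
      sum (λ i → N * v i + 2x * σ)
        ≈⟨ ∑-distrib-+ (λ i → N * v i) (λ _ → 2x * σ) ⟩
      sum (λ i → N * v i) + sum {n} (λ _ → 2x * σ)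
        ≈⟨ +-cong (≈-sym (*-distribˡ-sum N v))
             (≈-trans (sum-cong-≋ {n} (λ _ → ≈-sym (*-identityˡ (2x * σ))))
               (≈-sym (*-distribʳ-sum {n} (2x * σ) (λ _ → 1#)))) ⟩
      N * σ + sum {n} (λ _ → 1#) * (2x * σ)
        ≈⟨ +-congˡ (*-congʳ ones) ⟩
      N * σ + N * (2x * σ) ∎)

  -- Carries integer identities between sums over to the ring, so that everything about signs can be
  -- proved in ℤ.
  module IntegerImage (φ : ℤ → Carrier) (φ-0 : φ 0ℤ ≈ 0#) (φ-+ : ∀ i j → φ (i ℤ.+ j) ≈ φ i + φ j)
                      (φ-* : ∀ i j → φ (i ℤ.* j) ≈ φ i * φ j) where

    φ-∑ : ∀ {n} (f : Vector ℤ n) → φ (∑ f) ≈ sum (φ ∘ f)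
    φ-∑ {zero}  f = φ-0
    φ-∑ {suc n} f = ≈-trans (φ-+ (f zero) _) (+-congˡ (φ-∑ (f ∘ suc)))

    φ-∑* : ∀ {n} (f g : Vector ℤ n) → φ (∑ (λ i → f i ℤ.* g i)) ≈ sum (λ i → φ (f i) * φ (g i))
    φ-∑* f g = ≈-trans (φ-∑ (λ i → f i ℤ.* g i)) (sum-cong-≋ λ i → φ-* (f i) (g i))

    φ-∑∑ : ∀ {m n} (f : Fin m → Fin n → ℤ) → φ (∑ (λ i → ∑ (f i))) ≈ sum (λ i → sum (λ j → φ (f i j)))
    φ-∑∑ f = ≈-trans (φ-∑ (λ i → ∑ (f i))) (sum-cong-≋ λ i → φ-∑ (f i))

-- Sums of integers and matrices of signs

open MonoidSums ℤ.+-0-commutativeMonoid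
  using (∑-distrib-+; ∑-comm; sum-cong-≗; sum-zero; sum-single; sum-combine)
open Algebra.Properties.Semiring.Sum ℤ.+-*-semiring using (*-distribˡ-sum; *-distribʳ-sum)
module ℤ+ = Algebra.Properties.AbelianGroup ℤ.+-0-abelianGroup

private
  variable
    m n : ℕ

-- Differences of vectors are written with `c = -1ℤ`, so that this one rule serves for sums and
-- differences alike.
∑-linear : ∀ (f g : Vector ℤ n) c → ∑ (λ i → f i ℤ.+ c ℤ.* g i) ≡ ∑ f ℤ.+ c ℤ.* ∑ g
∑-linear f g c = trans (∑-distrib-+ f (λ i → c ℤ.* g i)) (cong (λ s → ∑ f ℤ.+ s) (sym (*-distribˡ-sum c g)))

∑-ones : ∀ n → ∑ {n} (λ _ → 1ℤ) ≡ ℤ.+ n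
∑-ones zero    = refl
∑-ones (suc n) = cong (λ s → 1ℤ ℤ.+ s) (∑-ones n)

-- The common source of multiplicativity: row sums, totals and squares of Kronecker products are all
-- sums of this kind.
∑-combine-* : ∀ (f : Vector ℤ (m ℕ.* n)) (g : Vector ℤ m) (h : Vector ℤ n) →
              (∀ i j → f (combine i j) ≡ g i ℤ.* h j) → ∑ f ≡ ∑ g ℤ.* ∑ h
∑-combine-* {m} {n} f g h f≡g*h = begin
  ∑ f              ≡⟨ sum-combine m f ⟩
  ∑ {m} (λ i → ∑ {n} (λ j → f (combine i j)))
    ≡⟨ sum-cong-≗ (λ i → trans (sum-cong-≗ (f≡g*h i)) (sym (*-distribˡ-sum (g i) h))) ⟩
  ∑ (λ i → g i ℤ.* ∑ h)    ≡⟨ *-distribʳ-sum (∑ h) g ⟨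
  ∑ g ℤ.* ∑ h                        ∎
  where open ≡-Reasoning

𝟙 : ∀ {p} {P : Set p} → Dec P → ℤ
𝟙 P? = if does P? then 1ℤ else 0ℤ

length-filter-tabulate : ∀ {A : Set} {p} {P : Pred A p} (P? : Decidable P) (f : Fin n → A) →
                         ℤ.+ length (filter P? (tabulate f)) ≡ ∑ (λ i → 𝟙 (P? (f i)))
length-filter-tabulate {n = zero}  P? f = refl
length-filter-tabulate {n = suc n} P? f with does (P? (f zero))
... | true  = cong (λ s → 1ℤ ℤ.+ s) (length-filter-tabulate P? (f ∘ suc))
... | false = trans (length-filter-tabulate P? (f ∘ suc)) (sym (ℤ.+-identityˡ _))

⟦_⟧ : Sign → ℤ
⟦ s ⟧ = s ◃ 1

⟦⟧-* : ∀ s t → ⟦ s Sign.* t ⟧ ≡ ⟦ s ⟧ ℤ.* ⟦ t ⟧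
⟦⟧-* Sign.- Sign.- = refl
⟦⟧-* Sign.- Sign.+ = refl
⟦⟧-* Sign.+ Sign.- = refl
⟦⟧-* Sign.+ Sign.+ = refl

SignMatrix : ℕ → Set
SignMatrix n = Fin n → Fin n → Sign

infixr 7 _·_

_·_ : SignMatrix n → Vector ℤ n → Vector ℤ n
(K · v) i = ∑ (λ j → ⟦ K i j ⟧ ℤ.* v j)

rowSum : SignMatrix n → Vector ℤ n
rowSum K i = ∑ (λ j → ⟦ K i j ⟧)

column : SignMatrix n → Fin n → Vector ℤ n
column K j i = ⟦ K i j ⟧

-- A symmetric Hadamard matrix with constant diagonal whose entries sum to its order. The field
-- `orthogonal` is the off-diagonal part of `K² = n I`; the diagonal part is `square-diagonal`
-- below.
record Balanced {n} (K : SignMatrix n) : Set where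
  field
    symmetric  : ∀ i j → K i j ≡ K j i
    diagonal   : ∀ i → K i i ≡ Sign.+
    orthogonal : ∀ i j → i ≢ j → (K · column K j) i ≡ 0ℤ
    total      : ∑ (rowSum K) ≡ ℤ.+ n

-- Kronecker products of balanced matrices.

infixr 7 _⊗_

_⊗_ : SignMatrix m → SignMatrix n → SignMatrix (m ℕ.* n)
_⊗_ {m} {n} K L i j =
  K (quotient n i) (quotient n j) Sign.* L (remainder {m} n i) (remainder {m} n j)

quotient-combine : ∀ (i : Fin m) (j : Fin n) → quotient n (combine i j) ≡ i
quotient-combine i j = cong proj₁ (Fin.remQuot-combine i j)

remainder-combine : ∀ (i : Fin m) (j : Fin n) → remainder {m} n (combine i j) ≡ j
remainder-combine i j = cong proj₂ (Fin.remQuot-combine i j)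

module _ (K : SignMatrix m) (L : SignMatrix n) where

  -- Only the column, which is the index of summation later, is split by `combine`; the row `i`
  -- stays arbitrary, as the statements about rows require.
  ⊗-row : ∀ i c d → ⟦ (K ⊗ L) i (combine c d) ⟧ ≡ ⟦ K (quotient n i) c ⟧ ℤ.* ⟦ L (remainder {m} n i) d ⟧
  ⊗-row i c d = trans (⟦⟧-* (K _ _) (L _ _))
    (cong₂ (λ c d → ⟦ K (quotient n i) c ⟧ ℤ.* ⟦ L (remainder {m} n i) d ⟧)
      (quotient-combine c d) (remainder-combine c d))

  ⊗-column : ∀ i c d → ⟦ (K ⊗ L) (combine c d) i ⟧ ≡ ⟦ K c (quotient n i) ⟧ ℤ.* ⟦ L d (remainder {m} n i) ⟧
  ⊗-column i c d = trans (⟦⟧-* (K _ _) (L _ _))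
    (cong₂ (λ c d → ⟦ K c (quotient n i) ⟧ ℤ.* ⟦ L d (remainder {m} n i) ⟧)
      (quotient-combine c d) (remainder-combine c d))

  rowSum-⊗ : ∀ i → rowSum (K ⊗ L) i ≡ rowSum K (quotient n i) ℤ.* rowSum L (remainder {m} n i)
  rowSum-⊗ i = ∑-combine-* _ _ _ (⊗-row i)

  rowSum-⊗-combine : ∀ a b → rowSum (K ⊗ L) (combine a b) ≡ rowSum K a ℤ.* rowSum L b
  rowSum-⊗-combine a b = trans (rowSum-⊗ (combine a b))
    (cong₂ (λ a b → rowSum K a ℤ.* rowSum L b) (quotient-combine a b) (remainder-combine a b))

  -- The mixed product rule `(K ⊗ L)² = K² ⊗ L²`, entry by entry.
  ⊗-square : ∀ i j → ((K ⊗ L) · column (K ⊗ L) j) i ≡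
    (K · column K (quotient n j)) (quotient n i) ℤ.*
    (L · column L (remainder {m} n j)) (remainder {m} n i)
  ⊗-square i j = ∑-combine-* _ _ _ λ c d →
    trans (cong₂ ℤ._*_ (⊗-row i c d) (⊗-column j c d))
          (interchange ⟦ K (quotient n i) c ⟧ ⟦ L (remainder {m} n i) d ⟧
                       ⟦ K c (quotient n j) ⟧ ⟦ L d (remainder {m} n j) ⟧)
    where
    open ℤ-Solver using (solve; _:=_; _:*_)
    interchange : ∀ a b c d → (a ℤ.* b) ℤ.* (c ℤ.* d) ≡ (a ℤ.* c) ℤ.* (b ℤ.* d)
    interchange = solve 4 (λ a b c d → (a :* b) :* (c :* d) := (a :* c) :* (b :* d)) refl

  ⊗-balanced : Balanced K → Balanced L → Balanced (K ⊗ L)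
  ⊗-balanced bK bL = record
    { symmetric  = λ i j → cong₂ Sign._*_ (K.symmetric _ _) (L.symmetric _ _)
    ; diagonal   = λ i → cong₂ Sign._*_ (K.diagonal _) (L.diagonal _)
    ; orthogonal = orthogonal
    ; total      = begin
        ∑ (rowSum (K ⊗ L))               ≡⟨ ∑-combine-* _ _ _ rowSum-⊗-combine ⟩
        ∑ (rowSum K) ℤ.* ∑ (rowSum L)    ≡⟨ cong₂ ℤ._*_ K.total L.total ⟩
        ℤ.+ m ℤ.* ℤ.+ n                  ≡⟨ ℤ.pos-* m n ⟨
        ℤ.+ (m ℕ.* n)                    ∎
    }
    where
    open ≡-Reasoning
    module K = Balanced bK
    module L = Balanced bL
    orthogonal : ∀ i j → i ≢ j → ((K ⊗ L) · column (K ⊗ L) j) i ≡ 0ℤ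
    -- Distinct indices differ in at least one of their two parts, and the corresponding factor in
    -- `⊗-square` vanishes.
    orthogonal i j i≢j with quotient n i Fin.≟ quotient n j | remainder {m} n i Fin.≟ remainder {m} n j
    ... | no q≢ | _ = trans (⊗-square i j) (cong (ℤ._* _) (K.orthogonal _ _ q≢))
    ... | yes _ | no r≢ = trans (⊗-square i j)
      (trans (cong ((K · column K (quotient n j)) (quotient n i) ℤ.*_) (L.orthogonal _ _ r≢))
             (ℤ.*-zeroʳ ((K · column K (quotient n j)) (quotient n i))))
    ... | yes q≡ | yes r≡ = contradiction
      (trans (sym (Fin.combine-remQuot {m} n i))
        (trans (cong₂ combine q≡ r≡) (Fin.combine-remQuot {m} n j))) i≢j

-- Graphs of balanced matrices

open import Defs

-- Sending `i` to the position of `f i` in `xs` is injective, so the pigeonhole principle applies.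
length-≥-injection : ∀ {A : Set} {t} (f : Fin t → A) → Injective _≡_ _≡_ f →
                     ∀ {xs} → (∀ i → f i ∈ xs) → t ℕ.≤ length xs
length-≥-injection f f-inj {xs} f∈xs = Fin.injective⇒≤ {f = λ i → Any.index (f∈xs i)} λ {i} {j} eq →
  f-inj (trans (Any.lookup-index (f∈xs i)) (trans (cong (List.lookup xs) eq) (sym (Any.lookup-index (f∈xs j)))))

module _ (K : SignMatrix n) (symmetric : ∀ i j → K i j ≡ K j i) (diagonal : ∀ i → K i i ≡ Sign.+) where

  graph : Graph
  graph = record
    { order    = n
    ; _~_      = λ i j → K i j ≡ Sign.-
    ; _~?_     = λ i j → K i j Sign.≟ Sign.-
    ; ~-sym    = λ {i} {j} → trans (symmetric j i)
    ; ~-irrefl = λ { {i} refl Kii≡- → contradiction (trans (sym (diagonal i)) Kii≡-) λ () }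
    }

-- The adjacency matrix `(J - K) / 2` with integer entries.
negative : SignMatrix n → Fin n → Fin n → ℤ
negative K i j = 𝟙 (K i j Sign.≟ Sign.-)

2negative+⟦K⟧≡1 : ∀ (K : SignMatrix n) i j →
  negative K i j ℤ.+ negative K i j ℤ.+ ⟦ K i j ⟧ ≡ 1ℤ
2negative+⟦K⟧≡1 K i j with K i j
... | Sign.- = refl
... | Sign.+ = refl

unit : Fin n → Vector ℤ n
unit j i = 𝟙 (i Fin.≟ j)

unit-≡ : ∀ (i : Fin n) → unit i i ≡ 1ℤ
unit-≡ i rewrite dec-true (i Fin.≟ i) refl = refl

unit-≢ : ∀ {i j : Fin n} → i ≢ j → unit j i ≡ 0ℤ
unit-≢ {i = i} {j} i≢j rewrite dec-false (i Fin.≟ j) i≢j = refl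

∑-unit : ∀ (j : Fin n) → ∑ (unit j) ≡ 1ℤ
∑-unit j = trans (sum-single (unit j) j (λ _ → unit-≢)) (unit-≡ j)

·-unit : ∀ (K : SignMatrix n) j i → (K · unit j) i ≡ ⟦ K i j ⟧
·-unit K j i = trans
  (sum-single _ j (λ k k≢j → trans (cong (⟦ K i k ⟧ ℤ.*_) (unit-≢ k≢j)) (ℤ.*-zeroʳ ⟦ K i k ⟧)))
  (trans (cong (⟦ K i j ⟧ ℤ.*_) (unit-≡ j)) (ℤ.*-identityʳ ⟦ K i j ⟧))

·-linear : ∀ (K : SignMatrix n) f g c i →
  (K · (λ j → f j ℤ.+ c ℤ.* g j)) i ≡ (K · f) i ℤ.+ c ℤ.* (K · g) i
·-linear K f g c i = trans
  (sum-cong-≗ λ j → solve 4 (λ k f g c → k :* (f :+ c :* g) := k :* f :+ c :* (k :* g))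
       refl ⟦ K i j ⟧ (f j) (g j) c)
  (∑-linear (λ j → ⟦ K i j ⟧ ℤ.* f j) (λ j → ⟦ K i j ⟧ ℤ.* g j) c)
  where open ℤ-Solver using (solve; _:=_; _:*_; _:+_)

·-ones : ∀ (K : SignMatrix n) i → (K · λ _ → 1ℤ) i ≡ rowSum K i
·-ones K i = sum-cong-≗ λ j → ℤ.*-identityʳ ⟦ K i j ⟧

⟦s⟧²≡1 : ∀ s → ⟦ s ⟧ ℤ.* ⟦ s ⟧ ≡ 1ℤ
⟦s⟧²≡1 Sign.- = refl
⟦s⟧²≡1 Sign.+ = refl

-- The product is expanded in the form to which `∑-linear` applies three times in `commonNeighbour`.
[1-⟦s⟧][1-⟦t⟧]≡0 : ∀ s t → ¬ (s ≡ Sign.- × t ≡ Sign.-) →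
  1ℤ ℤ.+ -1ℤ ℤ.* ⟦ s ⟧ ℤ.+ -1ℤ ℤ.* (⟦ t ⟧ ℤ.+ -1ℤ ℤ.* (⟦ s ⟧ ℤ.* ⟦ t ⟧)) ≡ 0ℤ
[1-⟦s⟧][1-⟦t⟧]≡0 Sign.- Sign.- ¬-- = contradiction (refl , refl) ¬--
[1-⟦s⟧][1-⟦t⟧]≡0 Sign.- Sign.+ _   = refl
[1-⟦s⟧][1-⟦t⟧]≡0 Sign.+ Sign.- _   = refl
[1-⟦s⟧][1-⟦t⟧]≡0 Sign.+ Sign.+ _   = refl

-- For A = (J - K) / 2 this is A v = θ v.
IsIntegerEigenvector : SignMatrix n → ℤ → Vector ℤ n → Set
IsIntegerEigenvector K θ v = ∀ i → ∑ v ≡ (θ ℤ.+ θ) ℤ.* v i ℤ.+ (K · v) i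

-- From `2 A v = J v - K v` one gets `2 A v = 2 θ v`, and the factor 2 cancels in ℤ.
integerEigenvector⇒ : ∀ (K : SignMatrix n) {θ v} → IsIntegerEigenvector K θ v →
  ∀ i → ∑ (λ j → negative K i j ℤ.* v j) ≡ θ ℤ.* v i
integerEigenvector⇒ K {θ} {v} e i = ℤ.*-cancelˡ-≡ (ℤ.+ 2) _ _ (begin
  ℤ.+ 2 ℤ.* ∑ Av       ≡⟨ *-distribˡ-sum (ℤ.+ 2) Av ⟩
  ∑ (λ j → ℤ.+ 2 ℤ.* Av j)
    ≡⟨ sum-cong-≗ (λ j → trans
         (solve 3 (λ a k v → con (ℤ.+ 2) :* (a :* v) := (a :+ a :+ k) :* v :+ con -1ℤ :* (k :* v))
              refl (negative K i j) ⟦ K i j ⟧ (v j))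
         (cong (ℤ._+ -1ℤ ℤ.* (⟦ K i j ⟧ ℤ.* v j)) (trans (cong (ℤ._* v j) (2negative+⟦K⟧≡1 K i j)) (ℤ.*-identityˡ (v j))))) ⟩
  ∑ (λ j → v j ℤ.+ -1ℤ ℤ.* (⟦ K i j ⟧ ℤ.* v j))
    ≡⟨ ∑-linear v (λ j → ⟦ K i j ⟧ ℤ.* v j) -1ℤ ⟩
  ∑ v ℤ.+ -1ℤ ℤ.* (K · v) i
    ≡⟨ cong (ℤ._+ -1ℤ ℤ.* (K · v) i) (e i) ⟩
  (θ ℤ.+ θ) ℤ.* v i ℤ.+ (K · v) i ℤ.+ -1ℤ ℤ.* (K · v) i
    ≡⟨ solve 3 (λ θ v k → (θ :+ θ) :* v :+ k :+ con -1ℤ :* k := con (ℤ.+ 2) :* (θ :* v))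
         refl θ (v i) ((K · v) i) ⟩
  ℤ.+ 2 ℤ.* (θ ℤ.* v i) ∎)
  where
  open ≡-Reasoning
  open ℤ-Solver using (solve; _:=_; _:*_; _:+_; con)
  Av : Vector ℤ _
  Av j = negative K i j ℤ.* v j

-- Eigenvectors, common neighbours and valencies.

module BalancedProperties (K : SignMatrix n) (bK : Balanced K) where
  open Balanced bK
  open ≡-Reasoning
  open ℤ-Solver using (solve; _:=_; _:*_; _:+_; :-_; con)

  G : Graph
  G = graph K symmetric diagonal

  open Graph G

  square-diagonal : ∀ i → (K · column K i) i ≡ ℤ.+ n
  square-diagonal i = trans
    (sum-cong-≗ λ j → trans (cong (λ s → ⟦ K i j ⟧ ℤ.* ⟦ s ⟧) (symmetric j i)) (⟦s⟧²≡1 (K i j)))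
    (∑-ones n)

  square : ∀ i j → (K · column K j) i ≡ ℤ.+ n ℤ.* unit j i
  square i j with i Fin.≟ j
  ... | yes refl = trans (square-diagonal i) (sym (ℤ.*-identityʳ (ℤ.+ n)))
  ... | no  i≢j  = trans (orthogonal i j i≢j) (sym (ℤ.*-zeroʳ (ℤ.+ n)))

  ∑-column : ∀ j → ∑ (column K j) ≡ rowSum K j
  ∑-column j = sum-cong-≗ λ i → cong ⟦_⟧ (symmetric i j)

  -- With `h = K 1` this is `K h = K² 1 = n 1`.
  ·-rowSum : ∀ i → (K · rowSum K) i ≡ ℤ.+ n
  ·-rowSum i = begin
    ∑ (λ j → ⟦ K i j ⟧ ℤ.* rowSum K j)
      ≡⟨ sum-cong-≗ (λ j → *-distribˡ-sum ⟦ K i j ⟧ (λ k → ⟦ K j k ⟧)) ⟩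
    ∑ (λ j → ∑ (λ k → ⟦ K i j ⟧ ℤ.* ⟦ K j k ⟧))
      ≡⟨ ∑-comm (λ j k → ⟦ K i j ⟧ ℤ.* ⟦ K j k ⟧) ⟩
    ∑ (λ k → (K · column K k) i)
      ≡⟨ sum-single _ i (λ k k≢i → orthogonal i k (k≢i ∘ sym)) ⟩
    (K · column K i) i
      ≡⟨ square-diagonal i ⟩
    ℤ.+ n ∎

  -- By `total` the entries of `h` sum to `n`, which is also every entry of `K h`.
  eigenvector-0 : IsIntegerEigenvector K 0ℤ (rowSum K)
  eigenvector-0 i = trans total (trans (sym (·-rowSum i)) (sym (ℤ.+-identityˡ _)))

  -- For `v = h - n 1` the sum of the entries is `n - n²`, and
  -- `n v + K v = (n h - n² 1) + (n 1 - n h)` has the same value in every entry.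
  eigenvector-n/2 : ∀ θ → θ ℤ.+ θ ≡ ℤ.+ n →
    IsIntegerEigenvector K θ (λ i → rowSum K i ℤ.+ ℤ.- (ℤ.+ n) ℤ.* 1ℤ)
  eigenvector-n/2 θ 2θ≡n i = begin
    ∑ (λ i → h i ℤ.+ ℤ.- N ℤ.* 1ℤ)    ≡⟨ ∑-linear h (λ _ → 1ℤ) (ℤ.- N) ⟩
    ∑ h ℤ.+ ℤ.- N ℤ.* ∑ {n} (λ _ → 1ℤ)     ≡⟨ cong₂ (λ s t → s ℤ.+ ℤ.- N ℤ.* t) total (∑-ones n) ⟩
    N ℤ.+ ℤ.- N ℤ.* N
      ≡⟨ solve 2 (λ N h → N :+ (:- N) :* N := N :* (h :+ (:- N) :* con 1ℤ) :+ (N :+ (:- N) :* h))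
           refl N (h i) ⟩
    N ℤ.* v ℤ.+ (N ℤ.+ ℤ.- N ℤ.* h i)
      ≡⟨ cong₂ (λ s t → s ℤ.* v ℤ.+ t) (sym 2θ≡n) (cong₂ (λ s t → s ℤ.+ ℤ.- N ℤ.* t) (sym (·-rowSum i)) (sym (·-ones K i))) ⟩
    (θ ℤ.+ θ) ℤ.* v ℤ.+ ((K · h) i ℤ.+ ℤ.- N ℤ.* (K · (λ _ → 1ℤ)) i)
      ≡⟨ cong (λ t → (θ ℤ.+ θ) ℤ.* v ℤ.+ t) (·-linear K h (λ _ → 1ℤ) (ℤ.- N) i) ⟨
    (θ ℤ.+ θ) ℤ.* v ℤ.+ (K · (λ i → h i ℤ.+ ℤ.- N ℤ.* 1ℤ)) i ∎
    where
    h = rowSum K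
    N = ℤ.+ n
    v = h i ℤ.+ ℤ.- N ℤ.* 1ℤ

  module _ (a b : Fin n) (ha≡hb : rowSum K a ≡ rowSum K b) where

    Δcolumn Δunit : Vector ℤ n
    Δcolumn i = column K a i ℤ.+ -1ℤ ℤ.* column K b i
    Δunit   i = unit a i ℤ.+ -1ℤ ℤ.* unit b i

    -- Here the equality of the row sums at `a` and `b` enters: it makes `K u` orthogonal to the
    -- all-ones vector for `u = e_a - e_b`.
    ∑-Δcolumn : ∑ Δcolumn ≡ 0ℤ
    ∑-Δcolumn = begin
      ∑ Δcolumn                          ≡⟨ ∑-linear (column K a) (column K b) -1ℤ ⟩
      ∑ (column K a) ℤ.+ -1ℤ ℤ.* ∑ (column K b)
        ≡⟨ cong₂ (λ s t → s ℤ.+ -1ℤ ℤ.* t) (trans (∑-column a) ha≡hb) (∑-column b) ⟩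
      rowSum K b ℤ.+ -1ℤ ℤ.* rowSum K b  ≡⟨ solve 1 (λ h → h :+ con -1ℤ :* h := con 0ℤ)
           refl (rowSum K b) ⟩
      0ℤ                                 ∎

    ∑-Δunit : ∑ Δunit ≡ 0ℤ
    ∑-Δunit = trans (∑-linear (unit a) (unit b) -1ℤ) (cong₂ (λ s t → s ℤ.+ -1ℤ ℤ.* t) (∑-unit a) (∑-unit b))

    ·-Δcolumn : ∀ i → (K · Δcolumn) i ≡ ℤ.+ n ℤ.* Δunit i
    ·-Δcolumn i = begin
      (K · Δcolumn) i
        ≡⟨ ·-linear K (column K a) (column K b) -1ℤ i ⟩
      (K · column K a) i ℤ.+ -1ℤ ℤ.* (K · column K b) i
        ≡⟨ cong₂ (λ s t → s ℤ.+ -1ℤ ℤ.* t) (square i a) (square i b) ⟩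
      ℤ.+ n ℤ.* unit a i ℤ.+ -1ℤ ℤ.* (ℤ.+ n ℤ.* unit b i)
        ≡⟨ solve 3 (λ N s t → N :* s :+ con -1ℤ :* (N :* t) := N :* (s :+ con -1ℤ :* t))
             refl (ℤ.+ n) (unit a i) (unit b i) ⟩
      ℤ.+ n ℤ.* Δunit i ∎

    ·-Δunit : ∀ i → (K · Δunit) i ≡ Δcolumn i
    ·-Δunit i = trans (·-linear K (unit a) (unit b) -1ℤ i)
      (cong₂ (λ s t → s ℤ.+ -1ℤ ℤ.* t) (·-unit K a i) (·-unit K b i))

    -- Since K² = n I, the vectors K u ± √n u are eigenvectors of K, and for
    -- u = e_a - e_b they are orthogonal to the all-ones vector.
    eigenvector-√n/2 : ∀ θ → (θ ℤ.+ θ) ℤ.* (θ ℤ.+ θ) ≡ ℤ.+ n →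
      IsIntegerEigenvector K θ (λ i → Δcolumn i ℤ.+ ℤ.- (θ ℤ.+ θ) ℤ.* Δunit i)
    eigenvector-√n/2 θ θ²≡n i = begin
      ∑ (λ i → Δcolumn i ℤ.+ ℤ.- (θ ℤ.+ θ) ℤ.* Δunit i)
        ≡⟨ ∑-linear Δcolumn Δunit (ℤ.- (θ ℤ.+ θ)) ⟩
      ∑ Δcolumn ℤ.+ ℤ.- (θ ℤ.+ θ) ℤ.* ∑ Δunit
        ≡⟨ cong₂ (λ s t → s ℤ.+ ℤ.- (θ ℤ.+ θ) ℤ.* t) ∑-Δcolumn ∑-Δunit ⟩
      0ℤ ℤ.+ ℤ.- (θ ℤ.+ θ) ℤ.* 0ℤ
        ≡⟨ solve 3 (λ c w u → con 0ℤ :+ (:- c) :* con 0ℤ := c :* (w :+ (:- c) :* u) :+ (c :* c :* u :+ (:- c) :* w))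
             refl (θ ℤ.+ θ) (Δcolumn i) (Δunit i) ⟩
      (θ ℤ.+ θ) ℤ.* v ℤ.+ ((θ ℤ.+ θ) ℤ.* (θ ℤ.+ θ) ℤ.* Δunit i ℤ.+ ℤ.- (θ ℤ.+ θ) ℤ.* Δcolumn i)
        ≡⟨ cong (λ t → (θ ℤ.+ θ) ℤ.* v ℤ.+ t) (cong₂ (λ s t → s ℤ.+ ℤ.- (θ ℤ.+ θ) ℤ.* t)
             (trans (cong (ℤ._* Δunit i) θ²≡n) (sym (·-Δcolumn i))) (sym (·-Δunit i))) ⟩
      (θ ℤ.+ θ) ℤ.* v ℤ.+ ((K · Δcolumn) i ℤ.+ ℤ.- (θ ℤ.+ θ) ℤ.* (K · Δunit) i)
        ≡⟨ cong (λ t → (θ ℤ.+ θ) ℤ.* v ℤ.+ t) (·-linear K Δcolumn Δunit (ℤ.- (θ ℤ.+ θ)) i) ⟨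
      (θ ℤ.+ θ) ℤ.* v ℤ.+ (K · (λ i → Δcolumn i ℤ.+ ℤ.- (θ ℤ.+ θ) ℤ.* Δunit i)) i ∎
      where
      v = Δcolumn i ℤ.+ ℤ.- (θ ℤ.+ θ) ℤ.* Δunit i

  -- The sum over `k` of `(1 - K i k) (1 - K k j)` is four times the number of common neighbours. It
  -- equals `n - h_i - h_j`, because the mixed term is an off-diagonal entry of `K²`. Without common
  -- neighbours every summand is zero, which would force `h_i + h_j = n`.
  commonNeighbour : ∀ i j → i ≢ j → rowSum K i ℤ.+ rowSum K j ℤ.< ℤ.+ n →
                    ∃[ k ] (i ~ k × k ~ j)
  commonNeighbour i j i≢j h<n with Fin.any? (λ k → (i ~? k) ×-dec (k ~? j))
  ... | yes k = k
  ... | no ¬k = contradiction h<n (ℤ.<-irrefl (begin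
      rowSum K i ℤ.+ rowSum K j
        -- The term `-1ℤ * 0ℤ` holds the place of the entry of `K²` that `orthogonal` makes zero.
        ≡⟨ solve 3 (λ s t N → s :+ t := N :+ con -1ℤ :* (N :+ con -1ℤ :* s :+ con -1ℤ :* (t :+ con -1ℤ :* con 0ℤ)))
             refl (rowSum K i) (rowSum K j) (ℤ.+ n) ⟩
      ℤ.+ n ℤ.+ -1ℤ ℤ.* (ℤ.+ n ℤ.+ -1ℤ ℤ.* rowSum K i ℤ.+ -1ℤ ℤ.* (rowSum K j ℤ.+ -1ℤ ℤ.* 0ℤ))
        ≡⟨ cong (λ s → ℤ.+ n ℤ.+ -1ℤ ℤ.* s) count ⟩
      ℤ.+ n ℤ.+ -1ℤ ℤ.* 0ℤ
        ≡⟨ ℤ.+-identityʳ (ℤ.+ n) ⟩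
      ℤ.+ n ∎))
    where
    x y xy : Vector ℤ n
    x k = ⟦ K i k ⟧
    y k = ⟦ K k j ⟧
    xy k = x k ℤ.* y k
    count : ℤ.+ n ℤ.+ -1ℤ ℤ.* rowSum K i ℤ.+ -1ℤ ℤ.* (rowSum K j ℤ.+ -1ℤ ℤ.* 0ℤ) ≡ 0ℤ
    count = begin
      ℤ.+ n ℤ.+ -1ℤ ℤ.* ∑ x ℤ.+ -1ℤ ℤ.* (rowSum K j ℤ.+ -1ℤ ℤ.* 0ℤ)
        ≡⟨ cong₂ (λ s t → s ℤ.+ -1ℤ ℤ.* ∑ x ℤ.+ -1ℤ ℤ.* t) (sym (∑-ones n))
             (cong₂ (λ s t → s ℤ.+ -1ℤ ℤ.* t) (sym (∑-column j)) (sym (orthogonal i j i≢j))) ⟩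
      ∑ {n} (λ _ → 1ℤ) ℤ.+ -1ℤ ℤ.* ∑ x ℤ.+ -1ℤ ℤ.* (∑ y ℤ.+ -1ℤ ℤ.* ∑ xy)
        ≡⟨ cong₂ (λ s t → s ℤ.+ -1ℤ ℤ.* t) (∑-linear (λ _ → 1ℤ) x -1ℤ) (∑-linear y xy -1ℤ) ⟨
      ∑ (λ k → 1ℤ ℤ.+ -1ℤ ℤ.* x k) ℤ.+ -1ℤ ℤ.* ∑ (λ k → y k ℤ.+ -1ℤ ℤ.* xy k)
        ≡⟨ ∑-linear (λ k → 1ℤ ℤ.+ -1ℤ ℤ.* x k) (λ k → y k ℤ.+ -1ℤ ℤ.* xy k) -1ℤ ⟨
      ∑ (λ k → 1ℤ ℤ.+ -1ℤ ℤ.* x k ℤ.+ -1ℤ ℤ.* (y k ℤ.+ -1ℤ ℤ.* xy k))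
        ≡⟨ sum-zero _ (λ k → [1-⟦s⟧][1-⟦t⟧]≡0 (K i k) (K k j) (λ p → ¬k (k , p))) ⟩
      0ℤ ∎

  2valency+rowSum≡n : ∀ i → ℤ.+ valency i ℤ.+ ℤ.+ valency i ℤ.+ rowSum K i ≡ ℤ.+ n
  2valency+rowSum≡n i = begin
    ℤ.+ valency i ℤ.+ ℤ.+ valency i ℤ.+ rowSum K i
      ≡⟨ cong (λ s → s ℤ.+ s ℤ.+ rowSum K i) (length-filter-tabulate (i ~?_) id) ⟩
    ∑ (negative K i) ℤ.+ ∑ (negative K i) ℤ.+ rowSum K i
      ≡⟨ cong (ℤ._+ rowSum K i) (∑-distrib-+ (negative K i) (negative K i)) ⟨
    ∑ (λ j → negative K i j ℤ.+ negative K i j) ℤ.+ rowSum K i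
      ≡⟨ ∑-distrib-+ (λ j → negative K i j ℤ.+ negative K i j) (λ j → ⟦ K i j ⟧) ⟨
    ∑ (λ j → negative K i j ℤ.+ negative K i j ℤ.+ ⟦ K i j ⟧)
      ≡⟨ sum-cong-≗ (2negative+⟦K⟧≡1 K i) ⟩
    ∑ {n} (λ _ → 1ℤ)
      ≡⟨ ∑-ones n ⟩
    ℤ.+ n ∎

  -- A valency determines its row sum through `2valency+rowSum≡n`, so vertices with distinct row
  -- sums have distinct valencies.
  length-distinctValencies : ∀ {t} (f : Fin t → Fin n) → Injective _≡_ _≡_ (rowSum K ∘ f) →
                             t ℕ.≤ length distinctValencies
  length-distinctValencies f inj = length-≥-injection (valency ∘ f)
    (λ {i} {j} eq → inj (ℤ+.∙-cancelˡ (ℤ.+ valency (f i) ℤ.+ ℤ.+ valency (f i)) _ _ (begin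
       ℤ.+ valency (f i) ℤ.+ ℤ.+ valency (f i) ℤ.+ rowSum K (f i) ≡⟨ 2valency+rowSum≡n (f i) ⟩
       ℤ.+ n ≡⟨ 2valency+rowSum≡n (f j) ⟨
       ℤ.+ valency (f j) ℤ.+ ℤ.+ valency (f j) ℤ.+ rowSum K (f j)
         ≡⟨ cong (λ d → ℤ.+ d ℤ.+ ℤ.+ d ℤ.+ rowSum K (f j)) eq ⟨
       ℤ.+ valency (f i) ℤ.+ ℤ.+ valency (f i) ℤ.+ rowSum K (f j) ∎)))
    (λ i → ∈-deduplicate⁺ ℕ._≟_ (∈-map⁺ valency (∈-allFin (f i))))

  module _ (h<n : ∀ i j → rowSum K i ℤ.+ rowSum K j ℤ.< ℤ.+ n) where

    connected : Fin n → Connected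
    connected i₀ = (λ { refl → contradiction i₀ λ () }) , walk
      where
      walk : ∀ i j → Star _~_ i j
      walk i j with i Fin.≟ j
      ... | yes refl = ε-walk
      ... | no i≢j with commonNeighbour i j i≢j (h<n i j)
      ...   | k , i~k , k~j = i~k ◅ k~j ◅ ε-walk

    ~⇒≢ : ∀ {i j} → i ~ j → i ≢ j
    ~⇒≢ i~j i≡j = ~-irrefl i≡j i~j

    -- A common neighbour `k` of `i` and `j` provides an edge from `i` to `k`, and a common
    -- neighbour `l` of its ends closes a triangle. Both `k` and `l` would lie on the side opposite
    -- to `i`, although they are adjacent.
    not-bipartite : ∀ i j → i ≢ j → ¬ Bipartite
    not-bipartite i j i≢j (side , proper) with commonNeighbour i j i≢j (h<n i j)
    ... | k , i~k , _ with commonNeighbour i k (~⇒≢ i~k) (h<n i k)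
    ...   | l , i~l , l~k = proper l~k (trans (Bool.¬-not (proper i~l ∘ sym)) (sym (Bool.¬-not (proper i~k ∘ sym))))

-- The ring of reals

-- By unfolding, `x ≈ y` says that the termwise difference is `Null`. Congruence of the ring
-- operations thus reduces to closure of null sequences under sums, negation and bounded factors.
Null Bounded : (ℕ → ℚ) → Set
Null f    = ∀ ε → 0ℚ ℚ.< ε → Eventually (λ n → ℚ.∣ f n ∣ ℚ.< ε)
Bounded f = ∃[ B ] (0ℚ ℚ.< B × Eventually (λ n → ℚ.∣ f n ∣ ℚ.≤ B))

eventually-map : ∀ {P Q : ℕ → Set} → (∀ n → P n → Q n) → Eventually P → Eventually Q
eventually-map f (N , h) = N , λ n N≤n → f n (h n N≤n)

eventually-× : ∀ {P Q : ℕ → Set} → Eventually P → Eventually Q →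
               Eventually (λ n → P n × Q n)
eventually-× (M , f) (N , g) = M ⊔ N , λ n ≤n →
  f n (ℕ.m⊔n≤o⇒m≤o M N ≤n) , g n (ℕ.m⊔n≤o⇒n≤o M N ≤n)

eventually-witness : ∀ {P : Set} → Eventually (λ _ → P) → P
eventually-witness (N , h) = h N ℕ.≤-refl

0<*⇒0< : ∀ {p q} → 0ℚ ℚ.< p → 0ℚ ℚ.< q → 0ℚ ℚ.< p ℚ.* q
0<*⇒0< {p} {q} 0<p 0<q =
  ℚ.positive⁻¹ _ {{ℚ.pos*pos⇒pos p {{ℚ.positive 0<p}} q {{ℚ.positive 0<q}}}}

½+½ : ∀ ε → ½ ℚ.* ε ℚ.+ ½ ℚ.* ε ≡ ε
½+½ = solve 1 (λ ε → con ½ :* ε :+ con ½ :* ε := ε) refl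
  where open ℚ-Solver

0<½ : 0ℚ ℚ.< ½
0<½ = ℚ.positive⁻¹ ½

p≡[p-q]+q : ∀ p q → p ≡ (p ℚ.- q) ℚ.+ q
p≡[p-q]+q = solve 2 (λ p q → p := (p :- q) :+ q) refl
  where open ℚ-Solver

cauchy⇒bounded : ∀ f → Cauchy f → Bounded f
cauchy⇒bounded f cf with cf 1ℚ (ℚ.positive⁻¹ 1ℚ)
... | N , h = 1ℚ ℚ.+ ℚ.∣ f N ∣
            , ℚ.+-mono-<-≤ (ℚ.positive⁻¹ 1ℚ) (ℚ.0≤∣p∣ (f N))
            , N , λ n N≤n → begin
  ℚ.∣ f n ∣
    ≡⟨ cong ℚ.∣_∣ (p≡[p-q]+q (f n) (f N)) ⟩
  ℚ.∣ (f n ℚ.- f N) ℚ.+ f N ∣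
    ≤⟨ ℚ.∣p+q∣≤∣p∣+∣q∣ (f n ℚ.- f N) (f N) ⟩
  ℚ.∣ f n ℚ.- f N ∣ ℚ.+ ℚ.∣ f N ∣
    ≤⟨ ℚ.+-monoˡ-≤ ℚ.∣ f N ∣ (ℚ.<⇒≤ (h n N N≤n ℕ.≤-refl)) ⟩
  1ℚ ℚ.+ ℚ.∣ f N ∣ ∎
  where
  open ℚ.≤-Reasoning

null-resp-≗ : ∀ {f g} → f ≗ g → Null f → Null g
null-resp-≗ f≗g nf ε 0<ε =
  eventually-map (λ n → subst (λ p → ℚ.∣ p ∣ ℚ.< ε) (f≗g n)) (nf ε 0<ε)

null-+ : ∀ {f g} → Null f → Null g → Null (λ n → f n ℚ.+ g n)
null-+ {f} {g} nf ng ε 0<ε =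
  eventually-map (λ { n (f< , g<) → begin-strict
      ℚ.∣ f n ℚ.+ g n ∣         ≤⟨ ℚ.∣p+q∣≤∣p∣+∣q∣ (f n) (g n) ⟩
      ℚ.∣ f n ∣ ℚ.+ ℚ.∣ g n ∣   <⟨ ℚ.+-mono-< f< g< ⟩
      ½ ℚ.* ε ℚ.+ ½ ℚ.* ε       ≡⟨ ½+½ ε ⟩
      ε                         ∎ })
    (eventually-× (nf (½ ℚ.* ε) 0<½ε) (ng (½ ℚ.* ε) 0<½ε))
  where
  open ℚ.≤-Reasoning
  0<½ε = 0<*⇒0< {½} {ε} 0<½ 0<ε

null-neg : ∀ {f} → Null f → Null (λ n → ℚ.- f n)
null-neg {f} nf ε 0<ε =
  eventually-map (λ n → subst (ℚ._< ε) (sym (ℚ.∣-p∣≡∣p∣ (f n)))) (nf ε 0<ε)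

null-* : ∀ {f g} → Bounded f → Null g → Null (λ n → f n ℚ.* g n)
null-* {f} {g} (B , 0<B , f≤B) ng ε 0<ε =
  eventually-map (λ { n (f≤ , g<) → begin-strict
      ℚ.∣ f n ℚ.* g n ∣         ≡⟨ ℚ.∣p*q∣≡∣p∣*∣q∣ (f n) (g n) ⟩
      ℚ.∣ f n ∣ ℚ.* ℚ.∣ g n ∣   ≤⟨ ℚ.*-monoʳ-≤-nonNeg ℚ.∣ g n ∣ {{ℚ.∣-∣-nonNeg (g n)}} f≤ ⟩
      B ℚ.* ℚ.∣ g n ∣           <⟨ ℚ.*-monoʳ-<-pos B g< ⟩
      B ℚ.* (ℚ.1/ B ℚ.* ε)      ≡⟨ ℚ.*-assoc B (ℚ.1/ B) ε ⟨
      B ℚ.* ℚ.1/ B ℚ.* ε        ≡⟨ cong (ℚ._* ε) (ℚ.*-inverseʳ B) ⟩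
      1ℚ ℚ.* ε                  ≡⟨ ℚ.*-identityˡ ε ⟩
      ε                         ∎ })
    (eventually-× f≤B (ng (ℚ.1/ B ℚ.* ε)
      (0<*⇒0< (ℚ.positive⁻¹ (ℚ.1/ B) {{ℚ.1/pos⇒pos B}}) 0<ε)))
  where
  open ℚ.≤-Reasoning
  instance
    B-positive : ℚ.Positive B
    B-positive = ℚ.positive 0<B
    B-nonZero : ℚ.NonZero B
    B-nonZero = ℚ.pos⇒nonZero B

≗⇒≈ : ∀ {x y} → seq x ≗ seq y → x ≈ y
≗⇒≈ {x} {y} x≗y ε 0<ε = 0 , λ n _ →
  subst (ℚ._< ε) (sym (cong ℚ.∣_∣ (trans (cong (ℚ._- seq y n) (x≗y n)) (ℚ.+-inverseʳ (seq y n))))) 0<ε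

module _ where
  open ℚ-Solver

  ≈-sym : ∀ {x y} → x ≈ y → y ≈ x
  ≈-sym {x} {y} x≈y = null-resp-≗
    (λ n → solve 2 (λ a b → :- (a :- b) := b :- a) refl (seq x n) (seq y n))
    (null-neg x≈y)

  ≈-trans : ∀ {x y z} → x ≈ y → y ≈ z → x ≈ z
  ≈-trans {x} {y} {z} x≈y y≈z = null-resp-≗
    (λ n → solve 3 (λ a b c → (a :- b) :+ (b :- c) := a :- c) refl
             (seq x n) (seq y n) (seq z n))
    (null-+ x≈y y≈z)

  +-cong : ∀ {x y u v} → x ≈ y → u ≈ v → x + u ≈ y + v
  +-cong {x} {y} {u} {v} x≈y u≈v = null-resp-≗
    (λ n → solve 4 (λ a b c d → (a :- b) :+ (c :- d) := (a :+ c) :- (b :+ d)) refl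
             (seq x n) (seq y n) (seq u n) (seq v n))
    (null-+ x≈y u≈v)

  *-cong : ∀ {x y u v} → x ≈ y → u ≈ v → x * u ≈ y * v
  *-cong {x} {y} {u} {v} x≈y u≈v = null-resp-≗
    (λ n → solve 4 (λ a b c d → a :* (c :- d) :+ d :* (a :- b) := a :* c :- b :* d) refl
             (seq x n) (seq y n) (seq u n) (seq v n))
    (null-+ (null-* (cauchy⇒bounded (seq x) (cauchy x)) u≈v)
            (null-* (cauchy⇒bounded (seq v) (cauchy v)) x≈y))

  neg-cong : ∀ {x y} → x ≈ y → - x ≈ - y
  neg-cong {x} {y} x≈y = null-resp-≗
    (λ n → solve 2 (λ a b → :- (a :- b) := (:- a) :- (:- b)) refl (seq x n) (seq y n))
    (null-neg x≈y)

-- The ring laws hold termwise in ℚ. The reals are passed explicitly because `_≈_` unfolds to a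
-- statement about their sequences, from which they cannot be inferred.
ℝ-commutativeRing : CommutativeRing 0ℓ 0ℓ
ℝ-commutativeRing = record
  { Carrier = ℝ ; _≈_ = _≈_ ; _+_ = _+_ ; _*_ = _*_ ; -_ = -_ ; 0# = 0ℝ ; 1# = 1ℝ
  ; isCommutativeRing = record
    { isRing = record
      { +-isAbelianGroup = record
        { isGroup = record
          { isMonoid = record
            { isSemigroup = record
              { isMagma = record
                { isEquivalence = record
                  { refl = λ {x} → ≗⇒≈ {x} {x} (λ _ → refl)
                  ; sym = λ {x} {y} → ≈-sym {x} {y}
                  ; trans = λ {x} {y} {z} → ≈-trans {x} {y} {z} }
                ; ∙-cong = λ {x} {y} {u} {v} → +-cong {x} {y} {u} {v} }
              ; assoc = λ x y z → ≗⇒≈ {(x + y) + z} {x + (y + z)}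
                  (λ n → ℚ.+-assoc (seq x n) (seq y n) (seq z n)) }
            ; identity = (λ x → ≗⇒≈ {0ℝ + x} {x} (λ n → ℚ.+-identityˡ (seq x n)))
                       , (λ x → ≗⇒≈ {x + 0ℝ} {x} (λ n → ℚ.+-identityʳ (seq x n))) }
          ; inverse = (λ x → ≗⇒≈ {(- x) + x} {0ℝ} (λ n → ℚ.+-inverseˡ (seq x n)))
                    , (λ x → ≗⇒≈ {x + - x} {0ℝ} (λ n → ℚ.+-inverseʳ (seq x n)))
          ; ⁻¹-cong = λ {x} {y} → neg-cong {x} {y} }
        ; comm = λ x y → ≗⇒≈ {x + y} {y + x} (λ n → ℚ.+-comm (seq x n) (seq y n)) }
      ; *-cong = λ {x} {y} {u} {v} → *-cong {x} {y} {u} {v}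
      ; *-assoc = λ x y z → ≗⇒≈ {(x * y) * z} {x * (y * z)}
          (λ n → ℚ.*-assoc (seq x n) (seq y n) (seq z n))
      ; *-identity = (λ x → ≗⇒≈ {1ℝ * x} {x} (λ n → ℚ.*-identityˡ (seq x n)))
                   , (λ x → ≗⇒≈ {x * 1ℝ} {x} (λ n → ℚ.*-identityʳ (seq x n)))
      ; distrib = (λ x y z → ≗⇒≈ {x * (y + z)} {x * y + x * z}
                     (λ n → ℚ.*-distribˡ-+ (seq x n) (seq y n) (seq z n)))
                , (λ x y z → ≗⇒≈ {(y + z) * x} {y * x + z * x}
                     (λ n → ℚ.*-distribʳ-+ (seq x n) (seq y n) (seq z n)))
      }
    ; *-comm = λ x y → ≗⇒≈ {x * y} {y * x} (λ n → ℚ.*-comm (seq x n) (seq y n)) } }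

-- Apartness, cancellation and the embedding of the integers.

p-0≡p : ∀ p → p ℚ.- 0ℚ ≡ p
p-0≡p = solve 1 (λ p → p :- con 0ℚ := p) refl
  where open ℚ-Solver

≈0⇒¬#0 : ∀ {x} → x ≈ 0ℝ → ¬ x # 0ℝ
≈0⇒¬#0 x≈0 (ε , 0<ε , x≥ε) =
  eventually-witness (eventually-map (λ { n (< , ≥) → ℚ.<-irrefl refl (ℚ.<-≤-trans < ≥) })
    (eventually-× (x≈0 ε 0<ε) x≥ε))

-- Apartness bounds `y` away from zero by a fixed `δ`; wherever the product is smaller than `ε δ`,
-- the factor `x` must be smaller than `ε`.
*-cancelʳ-# : ∀ {x y} → y # 0ℝ → x * y ≈ 0ℝ → x ≈ 0ℝ
*-cancelʳ-# {x} {y} (δ , 0<δ , y≥δ) xy≈0 ε 0<ε =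
  eventually-map (λ { n (xy< , δ≤y) → ℚ.≰⇒> λ ε≤x → ℚ.<-irrefl refl (begin-strict
      ε ℚ.* δ
        ≤⟨ ℚ.*-monoˡ-≤-nonNeg ε {{ℚ.pos⇒nonNeg ε {{ℚ.positive 0<ε}}}} δ≤y ⟩
      ε ℚ.* ℚ.∣ seq y n ℚ.- 0ℚ ∣
        ≤⟨ ℚ.*-monoʳ-≤-nonNeg ℚ.∣ seq y n ℚ.- 0ℚ ∣ {{ℚ.∣-∣-nonNeg (seq y n ℚ.- 0ℚ)}} ε≤x ⟩
      ℚ.∣ seq x n ℚ.- 0ℚ ∣ ℚ.* ℚ.∣ seq y n ℚ.- 0ℚ ∣
        ≡⟨ cong₂ (λ p q → ℚ.∣ p ∣ ℚ.* ℚ.∣ q ∣) (p-0≡p (seq x n)) (p-0≡p (seq y n)) ⟩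
      ℚ.∣ seq x n ∣ ℚ.* ℚ.∣ seq y n ∣
        ≡⟨ ℚ.∣p*q∣≡∣p∣*∣q∣ (seq x n) (seq y n) ⟨
      ℚ.∣ seq x n ℚ.* seq y n ∣
        ≡⟨ cong ℚ.∣_∣ (p-0≡p (seq x n ℚ.* seq y n)) ⟨
      ℚ.∣ seq x n ℚ.* seq y n ℚ.- 0ℚ ∣
        <⟨ xy< ⟩
      ε ℚ.* δ ∎) })
    (eventually-× (xy≈0 (ε ℚ.* δ) (0<*⇒0< {ε} {δ} 0<ε 0<δ)) y≥δ)
  where open ℚ.≤-Reasoning

p≢q⇒0<∣p-q∣ : ∀ {p q} → p ≢ q → 0ℚ ℚ.< ℚ.∣ p ℚ.- q ∣
p≢q⇒0<∣p-q∣ {p} {q} p≢q = ℚ.≰⇒> λ ∣p-q∣≤0 → p≢q (trans (p≡[p-q]+q p q)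
  (trans (cong (ℚ._+ q) (ℚ.∣p∣≡0⇒p≡0 (p ℚ.- q) (ℚ.≤-antisym ∣p-q∣≤0 (ℚ.0≤∣p∣ (p ℚ.- q)))))
         (ℚ.+-identityˡ q)))

∣p-q∣≤∣r-p∣+∣r-q∣ : ∀ p q r → ℚ.∣ p ℚ.- q ∣ ℚ.≤ ℚ.∣ r ℚ.- p ∣ ℚ.+ ℚ.∣ r ℚ.- q ∣
∣p-q∣≤∣r-p∣+∣r-q∣ p q r = begin
  ℚ.∣ p ℚ.- q ∣
    ≡⟨ cong ℚ.∣_∣ (solve 3 (λ p q r → p :- q := (:- (r :- p)) :+ (r :- q)) refl p q r) ⟩
  ℚ.∣ ℚ.- (r ℚ.- p) ℚ.+ (r ℚ.- q) ∣
    ≤⟨ ℚ.∣p+q∣≤∣p∣+∣q∣ (ℚ.- (r ℚ.- p)) (r ℚ.- q) ⟩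
  ℚ.∣ ℚ.- (r ℚ.- p) ∣ ℚ.+ ℚ.∣ r ℚ.- q ∣
    ≡⟨ cong (ℚ._+ ℚ.∣ r ℚ.- q ∣) (ℚ.∣-p∣≡∣p∣ (r ℚ.- p)) ⟩
  ℚ.∣ r ℚ.- p ∣ ℚ.+ ℚ.∣ r ℚ.- q ∣ ∎
  where
  open ℚ.≤-Reasoning
  open ℚ-Solver

½-+-cancel : ∀ {p q r} → p ℚ.≤ q ℚ.+ r → q ℚ.< ½ ℚ.* p → ½ ℚ.* p ℚ.≤ r
½-+-cancel {p} {q} {r} p≤q+r q<½p = ℚ.≮⇒≥ λ r<½p → ℚ.<-irrefl refl (begin-strict
  p                      ≤⟨ p≤q+r ⟩
  q ℚ.+ r                <⟨ ℚ.+-mono-< q<½p r<½p ⟩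
  ½ ℚ.* p ℚ.+ ½ ℚ.* p    ≡⟨ ½+½ p ⟩
  p                      ∎)
  where open ℚ.≤-Reasoning

-- The tail of `x` stays within `½ d` of `seq x N`, so the triangle inequality leaves it at distance
-- at least `½ d` from `r`.
far⇒# : ∀ x d r N → 0ℚ ℚ.< d →
        (∀ n → N ℕ.≤ n → ℚ.∣ seq x n ℚ.- seq x N ∣ ℚ.< ½ ℚ.* d) →
        d ℚ.≤ ℚ.∣ seq x N ℚ.- r ∣ → x # fromℚ r
far⇒# x d r N 0<d close far = ½ ℚ.* d , 0<*⇒0< {½} {d} 0<½ 0<d , N , λ n N≤n →
  ½-+-cancel (ℚ.≤-trans far (∣p-q∣≤∣r-p∣+∣r-q∣ (seq x N) r (seq x n))) (close n N≤n)

-- Once x is known up to a quarter of ∣p - q∣, a rational approximation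
-- of x tells which of p and q it stays away from.
#-either : ∀ x {p q} → p ≢ q → x # fromℚ p ⊎ x # fromℚ q
#-either x {p} {q} p≢q = decide (cauchy x (½ ℚ.* d) (0<*⇒0< {½} {d} 0<½ 0<d))
  where
  d : ℚ
  d = ½ ℚ.* ℚ.∣ p ℚ.- q ∣
  0<d : 0ℚ ℚ.< d
  0<d = 0<*⇒0< {½} {ℚ.∣ p ℚ.- q ∣} 0<½ (p≢q⇒0<∣p-q∣ p≢q)
  decide : ∃[ N ] (∀ m n → N ℕ.≤ m → N ℕ.≤ n → ℚ.∣ seq x m ℚ.- seq x n ∣ ℚ.< ½ ℚ.* d) →
           x # fromℚ p ⊎ x # fromℚ q
  decide (N , close) with d ℚ.≤? ℚ.∣ seq x N ℚ.- p ∣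
  ... | yes far = inj₁ (far⇒# x d p N 0<d (λ n N≤n → close n N N≤n ℕ.≤-refl) far)
  ... | no near = inj₂ (far⇒# x d q N 0<d (λ n N≤n → close n N N≤n ℕ.≤-refl)
    (½-+-cancel (∣p-q∣≤∣r-p∣+∣r-q∣ p q (seq x N)) (ℚ.≰⇒> near)))

-- The comparison is made between unnormalised fractions with denominator one, where no reduction to
-- lowest terms intervenes.
fromℤ-+ : ∀ i j → fromℤ (i ℤ.+ j) ≡ fromℤ i ℚ.+ fromℤ j
fromℤ-+ i j = ℚ.toℚᵘ-injective (ℚᵘ.≃-sym (ℚᵘ.≃-trans (ℚ.toℚᵘ-homo-+ (fromℤ i) (fromℤ j))
  (ℚᵘ.*≡* (cong (ℤ._* ℤ.+ 1) (cong₂ ℤ._+_ (ℤ.*-identityʳ i) (ℤ.*-identityʳ j))))))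

fromℤ-* : ∀ i j → fromℤ (i ℤ.* j) ≡ fromℤ i ℚ.* fromℤ j
fromℤ-* i j = ℚ.toℚᵘ-injective (ℚᵘ.≃-sym (ℚ.toℚᵘ-homo-* (fromℤ i) (fromℤ j)))

fromℤ-neg : ∀ i → fromℤ (ℤ.- i) ≡ ℚ.- fromℤ i
fromℤ-neg i = ℚ.toℚᵘ-injective (ℚᵘ.≃-sym (ℚ.toℚᵘ-homo‿- (fromℤ i)))

fromℤ-injective : ∀ {i j} → fromℤ i ≡ fromℤ j → i ≡ j
fromℤ-injective = cong ℚ.numerator

#⇒-#0 : ∀ {x y} → x # y → x + - y # 0ℝ
#⇒-#0 {x} {y} (ε , 0<ε , x-y≥ε) = ε , 0<ε , eventually-map
  (λ n → subst (λ p → ε ℚ.≤ ℚ.∣ p ∣) (sym (p-0≡p (seq x n ℚ.- seq y n)))) x-y≥ε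

-≈0⇒≈ : ∀ {x y} → x + - y ≈ 0ℝ → x ≈ y
-≈0⇒≈ {x} {y} = null-resp-≗ (λ n → p-0≡p (seq x n ℚ.- seq y n))

*-cancelˡ-# : ∀ {x y} → x # 0ℝ → x * y ≈ 0ℝ → y ≈ 0ℝ
*-cancelˡ-# {x} {y} x#0 xy≈0 = *-cancelʳ-# {y} {x} x#0
  (≈-trans {y * x} {x * y} {0ℝ} (≗⇒≈ {y * x} {x * y} λ n → ℚ.*-comm (seq y n) (seq x n)) xy≈0)

-- Roots of products of linear factors.

rootProduct : ℝ → List ℚ → ℝ → ℝ
rootProduct x []       y = y
rootProduct x (p ∷ ps) y = (x + - fromℚ p) * rootProduct x ps y

rootProduct-swap : ∀ {x y} p q ps →
  rootProduct x (p ∷ q ∷ ps) y ≈ 0ℝ → rootProduct x (q ∷ p ∷ ps) y ≈ 0ℝ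
rootProduct-swap {x} {y} p q ps = ≈-trans
  {rootProduct x (q ∷ p ∷ ps) y} {rootProduct x (p ∷ q ∷ ps) y} {0ℝ}
  (≗⇒≈ {rootProduct x (q ∷ p ∷ ps) y} {rootProduct x (p ∷ q ∷ ps) y} λ n →
    swap (seq x n ℚ.- q) (seq x n ℚ.- p) (seq (rootProduct x ps y) n))
  where
  swap : ∀ a b c → a ℚ.* (b ℚ.* c) ≡ b ℚ.* (a ℚ.* c)
  swap = solve 3 (λ a b c → a :* (b :* c) := b :* (a :* c)) refl
    where open ℚ-Solver

rootProduct-drop : ∀ {x y} p ps → x # fromℚ p →
  rootProduct x (p ∷ ps) y ≈ 0ℝ → rootProduct x ps y ≈ 0ℝ
rootProduct-drop {x} {y} p ps x#p =
  *-cancelˡ-# {x + - fromℚ p} {rootProduct x ps y} (#⇒-#0 {x} {fromℚ p} x#p)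

-- Whether `x ≈ p` holds cannot be decided. But of two distinct roots `x` is apart from at least
-- one, and the factor of that root cancels. When a single root is left, `y` cancels instead.
rootProduct≈0⇒root : ∀ {x y} → y # 0ℝ → ∀ ps → Unique ps →
                     rootProduct x ps y ≈ 0ℝ → Any (λ p → x ≈ fromℚ p) ps
rootProduct≈0⇒root {x} {y} y#0 []           _ e = contradiction y#0 (≈0⇒¬#0 {y} e)
rootProduct≈0⇒root {x} {y} y#0 (p ∷ [])     _ e =
  here (-≈0⇒≈ {x} {fromℚ p} (*-cancelʳ-# {x + - fromℚ p} {y} y#0 e))
rootProduct≈0⇒root {x} {y} y#0 (p ∷ q ∷ ps) ((p≢q ∷ p∉ps) ∷ (q∉ps ∷ u)) e =
  [ (λ x#p → there (rootProduct≈0⇒root {x} {y} y#0 (q ∷ ps) (q∉ps ∷ u)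
                      (rootProduct-drop {x} {y} p (q ∷ ps) x#p e)))
  , (λ x#q → skip (rootProduct≈0⇒root {x} {y} y#0 (p ∷ ps) (p∉ps ∷ u)
                      (rootProduct-drop {x} {y} q (p ∷ ps) x#q
                        (rootProduct-swap {x} {y} p q ps e))))
  ]′ (#-either x p≢q)
  where
  skip : Any (λ p → x ≈ fromℚ p) (p ∷ ps) → Any (λ p → x ≈ fromℚ p) (p ∷ q ∷ ps)
  skip (here x≈p)  = here x≈p
  skip (there any) = there (there any)

-- Spectra of graphs of balanced matrices

module ℝ-Ring = CommutativeRing ℝ-commutativeRing
module ℝ-Sums = RingSums ℝ-commutativeRing

ι : ℤ → ℝ
ι i = fromℚ (fromℤ i)

ι-+ : ∀ i j → ι (i ℤ.+ j) ≈ ι i + ι j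
ι-+ i j = ≗⇒≈ {ι (i ℤ.+ j)} {ι i + ι j} (λ _ → fromℤ-+ i j)

ι-* : ∀ i j → ι (i ℤ.* j) ≈ ι i * ι j
ι-* i j = ≗⇒≈ {ι (i ℤ.* j)} {ι i * ι j} (λ _ → fromℤ-* i j)

open ℝ-Sums.IntegerImage ι (ℝ-Ring.refl {0ℝ}) ι-+ ι-*

ι-# : ∀ {i j} → i ≢ j → ι i # ι j
ι-# {i} {j} i≢j = ℚ.∣ fromℤ i ℚ.- fromℤ j ∣ , p≢q⇒0<∣p-q∣ (i≢j ∘ fromℤ-injective) , 0 , λ _ _ → ℚ.≤-refl

spectrum : ℤ → List ℤ
spectrum q = 0ℤ ∷ ℤ.+ 2 ℤ.* (q ℤ.* q) ∷ q ∷ ℤ.- q ∷ []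

spectrum-unique : ∀ p → 1 ℕ.< p → Unique (spectrum (ℤ.+ p))
spectrum-unique p@(suc (suc _)) 1<p =
    ((λ ()) ∷ (λ ()) ∷ (λ ()) ∷ [])
  ∷ ((λ 2p²≡p → ℕ.<-irrefl (sym (ℤ.+-injective 2p²≡p))
                  (ℕ.<-≤-trans (ℕ.m<m*n p p 1<p) (ℕ.m≤n*m (p ℕ.* p) 2))) ∷ (λ ()) ∷ [])
  ∷ ((λ ()) ∷ [])
  ∷ []
  ∷ []
spectrum-unique (suc zero) (ℕ.s≤s ())

module Spectrum {n} (K : SignMatrix n) (bK : Balanced K) where
  open Balanced bK
  open BalancedProperties K bK

  A : Matrix n
  A = Graph.adjacencyMatrix G

  A≡ι[negative] : ∀ i j → A i j ≡ ι (negative K i j)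
  A≡ι[negative] i j with does (K i j Sign.≟ Sign.-)
  ... | true  = refl
  ... | false = refl

  integerEigenvalue : ∀ θ v i → v i ≢ 0ℤ → IsIntegerEigenvector K θ v → IsEigenvalue A (ι θ)
  integerEigenvalue θ v i₀ vi₀≢0 e = ι ∘ v , (i₀ , ι-# vi₀≢0) , λ i → begin
    sum (λ j → A i j * ι (v j))
      ≡⟨ ℝ-Sums.sum-cong-≗ (λ j → cong (_* ι (v j)) (A≡ι[negative] i j)) ⟩
    sum (λ j → ι (negative K i j) * ι (v j))
      ≈⟨ φ-∑* (negative K i) v ⟨
    ι (∑ (λ j → negative K i j ℤ.* v j))
      ≡⟨ cong ι (integerEigenvector⇒ K {θ} {v} e i) ⟩
    ι (θ ℤ.* v i)
      ≈⟨ ι-* θ (v i) ⟩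
    ι θ * ι (v i) ∎
    where
    open Relation.Binary.Reasoning.Setoid ℝ-Ring.setoid

  2A+ιK≈1 : ∀ i j → A i j + A i j + ι ⟦ K i j ⟧ ≈ 1ℝ
  2A+ιK≈1 i j = begin
    A i j + A i j + ι ⟦ K i j ⟧
      ≡⟨ cong (λ a → a + a + ι ⟦ K i j ⟧) (A≡ι[negative] i j) ⟩
    ι a + ι a + ι ⟦ K i j ⟧
      ≈⟨ +-cong {ι (a ℤ.+ a)} {ι a + ι a} {ι ⟦ K i j ⟧} {ι ⟦ K i j ⟧} (ι-+ a a) (ℝ-Ring.refl {ι ⟦ K i j ⟧}) ⟨
    ι (a ℤ.+ a) + ι ⟦ K i j ⟧
      ≈⟨ ι-+ (a ℤ.+ a) ⟦ K i j ⟧ ⟨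
    ι (a ℤ.+ a ℤ.+ ⟦ K i j ⟧)
      ≡⟨ cong ι (2negative+⟦K⟧≡1 K i j) ⟩
    1ℝ ∎
    where
    open Relation.Binary.Reasoning.Setoid ℝ-Ring.setoid
    a = negative K i j

  module _ (q : ℤ) (4q²≡n : (q ℤ.+ q) ℤ.* (q ℤ.+ q) ≡ ℤ.+ n) where

    -- 16 x (x - 2q²) (x² - q²) v is a combination of the residuals of the two
    -- equations of Eigenequation, with coefficients 2x (2x - n) and 2x - h.
    eigenpolynomial : ∀ x v → (∀ i → (A *ᵥ v) i ≈ x * v i) →
                      ∀ i → rootProduct x (List.map fromℤ (spectrum q)) (v i) ≈ 0ℝ
    eigenpolynomial x v Av≈xv i = null-resp-≗
      {_} {λ k → seq (rootProduct x (List.map fromℤ (spectrum q)) (v i)) k ℚ.- 0ℚ}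
      pointwise
      (null-+ (null-* (cauchy⇒bounded (seq c₁) (cauchy c₁)) (hσ+4x²v≈Nv+2xσ i))
              (null-* (cauchy⇒bounded (seq c₂) (cauchy c₂)) 4x²σ≈2nxσ))
      where
      N : ℝ
      N = ι (ℤ.+ n)
      H : Matrix n
      H i j = ι ⟦ K i j ⟧
      ι-≡ : ∀ i {j} x → ι i ≈ x → i ≡ j → x ≈ ι j
      ι-≡ i x ιi≈x refl = ≈-sym {ι i} {x} ιi≈x
      open ℝ-Sums.Eigenequation A H N 2A+ιK≈1
        (λ i → ι-≡ ((K · column K i) i) (sum (λ k → H i k * H k i))
          (φ-∑* (λ k → ⟦ K i k ⟧) (column K i)) (square-diagonal i))
        (λ i j i≢j → ι-≡ ((K · column K j) i) (sum (λ k → H i k * H k j))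
          (φ-∑* (λ k → ⟦ K i k ⟧) (column K j)) (orthogonal i j i≢j))
        (ι-≡ (∑ (rowSum K)) (sum (λ i → sum (H i))) (φ-∑∑ (λ i j → ⟦ K i j ⟧)) total)
        (ι-≡ (∑ {n} (λ _ → 1ℤ)) (sum {n} (λ _ → 1ℝ)) (φ-∑ {n} (λ _ → 1ℤ)) (∑-ones n))
        x v Av≈xv

      -- Eliminating `σ` leaves `2x (2x - N) (2x 2x - N) v`, whose leading coefficient in `x` is 16,
      -- whereas `rootProduct` is monic in `x`.
      1/16 : ℚ
      1/16 = ℤ.+ 1 ℚ./ 16
      c₁ c₂ : ℝ
      c₁ = fromℚ 1/16 * (2x * (2x + - N))
      c₂ = fromℚ (ℚ.- 1/16) * (h i + - 2x)

      fromℤ-n : fromℤ (ℤ.+ n) ≡ (fromℤ q ℚ.+ fromℤ q) ℚ.* (fromℤ q ℚ.+ fromℤ q)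
      fromℤ-n = trans (cong fromℤ (sym 4q²≡n))
        (trans (fromℤ-* (q ℤ.+ q) (q ℤ.+ q)) (cong₂ ℚ._*_ (fromℤ-+ q q) (fromℤ-+ q q)))

      fromℤ-2q² : fromℤ (ℤ.+ 2 ℤ.* (q ℤ.* q)) ≡ fromℤ (ℤ.+ 2) ℚ.* (fromℤ q ℚ.* fromℤ q)
      fromℤ-2q² = trans (fromℤ-* (ℤ.+ 2) (q ℤ.* q)) (cong (fromℤ (ℤ.+ 2) ℚ.*_) (fromℤ-* q q))

      module _ where
        open ℚ-Solver
        -- The images of `n`, `2q²` and `-q` are variables tied to `q` by equations; matching on
        -- these leaves a polynomial identity for the ring solver.
        identity : ∀ x q N r s v h σ → N ≡ (q ℚ.+ q) ℚ.* (q ℚ.+ q) →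
          r ≡ fromℤ (ℤ.+ 2) ℚ.* (q ℚ.* q) → s ≡ ℚ.- q →
          1/16 ℚ.* ((x ℚ.+ x) ℚ.* ((x ℚ.+ x) ℚ.- N)) ℚ.*
            ((h ℚ.* σ ℚ.+ (x ℚ.+ x) ℚ.* (x ℚ.+ x) ℚ.* v) ℚ.- (N ℚ.* v ℚ.+ (x ℚ.+ x) ℚ.* σ)) ℚ.+
          ℚ.- 1/16 ℚ.* (h ℚ.- (x ℚ.+ x)) ℚ.*
            ((x ℚ.+ x) ℚ.* (x ℚ.+ x) ℚ.* σ ℚ.- N ℚ.* ((x ℚ.+ x) ℚ.* σ)) ≡
          (x ℚ.- 0ℚ) ℚ.* ((x ℚ.- r) ℚ.* ((x ℚ.- q) ℚ.* ((x ℚ.- s) ℚ.* v))) ℚ.- 0ℚ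
        identity x q _ _ _ v h σ refl refl refl = solve 5 (λ x q v h σ →
          let 2x = x :+ x ; N = (q :+ q) :* (q :+ q) in
          con 1/16 :* (2x :* (2x :- N)) :* ((h :* σ :+ 2x :* 2x :* v) :- (N :* v :+ 2x :* σ)) :+
          con (ℚ.- 1/16) :* (h :- 2x) :* (2x :* 2x :* σ :- N :* (2x :* σ)) :=
          (x :- con 0ℚ) :* ((x :- con (fromℤ (ℤ.+ 2)) :* (q :* q)) :* ((x :- q) :* ((x :- (:- q)) :* v))) :- con 0ℚ)
          refl x q v h σ

      pointwise : (λ k → seq c₁ k ℚ.* (seq (h i * σ + 2x * 2x * v i) k ℚ.- seq (N * v i + 2x * σ) k) ℚ.+
                         seq c₂ k ℚ.* (seq (2x * 2x * σ) k ℚ.- seq (N * (2x * σ)) k)) ≗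
                  (λ k → seq (rootProduct x (List.map fromℤ (spectrum q)) (v i)) k ℚ.- 0ℚ)
      pointwise k = identity (seq x k) (fromℤ q) (fromℤ (ℤ.+ n)) (fromℤ (ℤ.+ 2 ℤ.* (q ℤ.* q))) (fromℤ (ℤ.- q))
        (seq (v i) k) (seq (h i) k) (seq σ k) fromℤ-n fromℤ-2q² (fromℤ-neg q)

-- Exact spectra from annihilating polynomials.

lookup-≢ : ∀ {A : Set} {xs : List A} → Unique xs → ∀ i j → i ≢ j → List.lookup xs i ≢ List.lookup xs j
lookup-≢ (_   ∷ _) zero    zero    i≢j = contradiction refl i≢j
lookup-≢ (x∉ ∷ _)  zero    (suc j) _   = All.lookup x∉ (∈-lookup j)
lookup-≢ (x∉ ∷ _)  (suc i) zero    _   = All.lookup x∉ (∈-lookup i) ∘ sym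
lookup-≢ (_   ∷ u) (suc i) (suc j) i≢j = lookup-≢ u i j (i≢j ∘ cong suc)

-- The annihilating product is read off at a coordinate where the eigenvector is apart from zero;
-- there it forces the eigenvalue to be one of the listed roots.
integerSpectrum : ∀ {n} (A : Matrix n) (is : List ℤ) → Unique is → All (IsEigenvalue A ∘ ι) is →
  (∀ x v → (∀ i → (A *ᵥ v) i ≈ x * v i) → ∀ i → rootProduct x (List.map fromℤ is) (v i) ≈ 0ℝ) →
  HasExactlyDistinctEigenvalues (length is) A
integerSpectrum A is unique eigenvalues annihilates =
    ι ∘ List.lookup is
  , (λ i j i≢j → ι-# (lookup-≢ unique i j i≢j))
  , (λ i → All.lookup eigenvalues (∈-lookup i))
  , λ { x (v , (i , vi#0) , Av≈xv) →
        let x∈is = Any.map⁻ (rootProduct≈0⇒root {x} {v i} vi#0 (List.map fromℤ is)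
                     (Unique.map⁺ fromℤ-injective unique) (annihilates x v Av≈xv i))
        in Any.index x∈is , Any.lookup-index x∈is }

module FourEigenvalues {n} (K : SignMatrix n) (bK : Balanced K) (p : ℕ) (1<p : 1 ℕ.< p)
  (4p²≡n : (ℤ.+ p ℤ.+ ℤ.+ p) ℤ.* (ℤ.+ p ℤ.+ ℤ.+ p) ≡ ℤ.+ n)
  (h<n : ∀ i j → rowSum K i ℤ.+ rowSum K j ℤ.< ℤ.+ n)
  (a b : Fin n) (a≢b : a ≢ b) (ha≡hb : rowSum K a ≡ rowSum K b) (ha≢0 : rowSum K a ≢ 0ℤ) where

  open Balanced bK
  open BalancedProperties K bK
  open Spectrum K bK

  -- The entry at `a` of the eigenvector is `1 - K a b - 2 θ`, that is `-2 θ` or `2 - 2 θ` according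
  -- to the sign `K a b`. The two excluded values of `θ` are those for which it could vanish.
  θ≢0,1⇒eigenvalue : ∀ θ → (θ ℤ.+ θ) ℤ.* (θ ℤ.+ θ) ≡ ℤ.+ n → θ ≢ 0ℤ → θ ≢ 1ℤ → IsEigenvalue A (ι θ)
  θ≢0,1⇒eigenvalue θ 4θ²≡n θ≢0 θ≢1 =
    integerEigenvalue θ v a (va≢0 (K a b) ∘ trans (sym va≡)) (eigenvector-√n/2 a b ha≡hb θ 4θ²≡n)
    where
    open ℤ-Solver using (solve; _:=_; _:*_; _:+_; _:-_; :-_; con)
    v : Vector ℤ n
    v i = Δcolumn a b ha≡hb i ℤ.+ ℤ.- (θ ℤ.+ θ) ℤ.* Δunit a b ha≡hb i
    va≡ : v a ≡ 1ℤ ℤ.+ -1ℤ ℤ.* ⟦ K a b ⟧ ℤ.- ℤ.+ 2 ℤ.* θ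
    va≡ = trans
      (cong₂ (λ s t → s ℤ.+ -1ℤ ℤ.* ⟦ K a b ⟧ ℤ.+ ℤ.- (θ ℤ.+ θ) ℤ.* t) (cong ⟦_⟧ (diagonal a))
        (cong₂ (λ s t → s ℤ.+ -1ℤ ℤ.* t) (unit-≡ a) (unit-≢ a≢b)))
      (solve 2 (λ k θ → con 1ℤ :+ con -1ℤ :* k :+ :- (θ :+ θ) :* con 1ℤ := con 1ℤ :+ con -1ℤ :* k :- con (ℤ.+ 2) :* θ)
           refl ⟦ K a b ⟧ θ)
    va≢0 : ∀ s → 1ℤ ℤ.+ -1ℤ ℤ.* ⟦ s ⟧ ℤ.- ℤ.+ 2 ℤ.* θ ≢ 0ℤ
    va≢0 Sign.+ eq = θ≢0 (sym (ℤ.*-cancelˡ-≡ (ℤ.+ 2) 0ℤ θ (ℤ.i-j≡0⇒i≡j 0ℤ (ℤ.+ 2 ℤ.* θ) eq)))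
    va≢0 Sign.- eq = θ≢1 (sym (ℤ.*-cancelˡ-≡ (ℤ.+ 2) 1ℤ θ (ℤ.i-j≡0⇒i≡j (ℤ.+ 2) (ℤ.+ 2 ℤ.* θ) eq)))

  -- If the eigenvector `h - n 1` vanished at `a`, then `h_a = n`, contrary to `h_a + h_a < n`.
  hasEigenvalue-n/2 : IsEigenvalue A (ι (ℤ.+ 2 ℤ.* (ℤ.+ p ℤ.* ℤ.+ p)))
  hasEigenvalue-n/2 = integerEigenvalue _ _ a (λ v≡0 → ℤ.<-irrefl refl (begin-strict
      ℤ.+ n                            ≤⟨ ℤ.+≤+ (ℕ.m≤m+n n n) ⟩
      ℤ.+ n ℤ.+ ℤ.+ n                  ≡⟨ cong (λ i → i ℤ.+ i) (h≡n v≡0) ⟨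
      rowSum K a ℤ.+ rowSum K a        <⟨ h<n a a ⟩
      ℤ.+ n                            ∎))
    (eigenvector-n/2 (ℤ.+ 2 ℤ.* (ℤ.+ p ℤ.* ℤ.+ p)) (trans
      (solve 1 (λ p → con (ℤ.+ 2) :* (p :* p) :+ con (ℤ.+ 2) :* (p :* p) := (p :+ p) :* (p :+ p))
           refl (ℤ.+ p)) 4p²≡n))
    where
    open ℤ-Solver using (solve; _:=_; _:*_; _:+_; _:-_; :-_; con)
    open ℤ.≤-Reasoning
    h≡n : rowSum K a ℤ.+ ℤ.- (ℤ.+ n) ℤ.* 1ℤ ≡ 0ℤ → rowSum K a ≡ ℤ.+ n
    h≡n v≡0 = ℤ.i-j≡0⇒i≡j _ _ (trans (cong (λ i → rowSum K a ℤ.+ i) (sym (ℤ.*-identityʳ (ℤ.- (ℤ.+ n))))) v≡0)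

  ±p≢0,1 : ∀ p → 1 ℕ.< p → (ℤ.+ p ≢ 0ℤ × ℤ.+ p ≢ 1ℤ) × (ℤ.- (ℤ.+ p) ≢ 0ℤ × ℤ.- (ℤ.+ p) ≢ 1ℤ)
  ±p≢0,1 (suc (suc _)) _ = ((λ ()) , λ ()) , ((λ ()) , λ ())
  ±p≢0,1 (suc zero) (ℕ.s≤s ())

  fourEigenvalues : HasExactlyDistinctEigenvalues 4 A
  fourEigenvalues = let (p≢0 , p≢1) , (-p≢0 , -p≢1) = ±p≢0,1 p 1<p in
    integerSpectrum A (spectrum (ℤ.+ p)) (spectrum-unique p 1<p)
      ( integerEigenvalue 0ℤ (rowSum K) a ha≢0 eigenvector-0
      ∷ hasEigenvalue-n/2
      ∷ θ≢0,1⇒eigenvalue (ℤ.+ p) 4p²≡n p≢0 p≢1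
      ∷ θ≢0,1⇒eigenvalue (ℤ.- (ℤ.+ p)) (trans (4[-p]²≡4p² (ℤ.+ p)) 4p²≡n) -p≢0 -p≢1
      ∷ [])
      (eigenpolynomial (ℤ.+ p) 4p²≡n)
    where
    open ℤ-Solver using (solve; _:=_; _:*_; _:+_; _:-_; :-_; con)
    4[-p]²≡4p² : ∀ p → (ℤ.- p ℤ.+ ℤ.- p) ℤ.* (ℤ.- p ℤ.+ ℤ.- p) ≡ (p ℤ.+ p) ℤ.* (p ℤ.+ p)
    4[-p]²≡4p² = solve 1 (λ p → (:- p :+ :- p) :* (:- p :+ :- p) := (p :+ p) :* (p :+ p)) refl

-- Kronecker powers of a balanced matrix of order 16

-- The signs `(-1)^B(i,j)` of the nondegenerate alternating form `B` on F_2^2, with `0F` as zero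
-- vector: `B` is 1 exactly at pairs of distinct nonzero vectors.
symplectic : SignMatrix 4
symplectic zero    _       = Sign.+
symplectic (suc _) zero    = Sign.+
symplectic (suc i) (suc j) = if does (i Fin.≟ j) then Sign.+ else Sign.-

switching : Fin 4 → Fin 4 → Sign
switching 0F 1F = Sign.-
switching 0F 2F = Sign.-
switching 1F 0F = Sign.-
switching 2F 3F = Sign.-
switching _  _  = Sign.+

-- The switched rows and columns were found by a search for a set that makes
-- the sum of all entries 16 and leaves two distinct positive row sums.
base : SignMatrix 16
base i j = d i Sign.* d j Sign.* (symplectic ⊗ symplectic) i j
  where
  d : Fin 16 → Sign
  d i = switching (quotient 4 i) (remainder {4} 4 i)

-- All conditions are finite and are settled by evaluation.
base-balanced : Balanced base
base-balanced = record
  { symmetric  = from-yes (Fin.all? λ i → Fin.all? λ j → base i j Sign.≟ base j i)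
  ; diagonal   = from-yes (Fin.all? λ i → base i i Sign.≟ Sign.+)
  ; orthogonal = from-yes (Fin.all? λ i → Fin.all? λ j →
                   ¬? (i Fin.≟ j) →-dec ((base · column base j) i ℤ.≟ 0ℤ))
  ; total      = refl
  }

∣rowSum-base∣≤8 : ∀ i → ℤ.∣ rowSum base i ∣ ℕ.≤ 8
∣rowSum-base∣≤8 = from-yes (Fin.all? λ i → ℤ.∣ rowSum base i ∣ ℕ.≤? 8)

infixr 8 _⊗^_

_⊗^_ : ∀ {n} → SignMatrix n → ∀ k → SignMatrix (n ℕ.^ k)
(K ⊗^ zero)  = λ _ _ → Sign.+
(K ⊗^ suc k) = K ⊗ (K ⊗^ k)

⊗^-balanced : ∀ {n} {K : SignMatrix n} → Balanced K → ∀ k → Balanced (K ⊗^ k)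
⊗^-balanced bK zero    = record
  { symmetric  = λ _ _ → refl
  ; diagonal   = λ _ → refl
  ; orthogonal = λ { zero zero 0≢0 → contradiction refl 0≢0 }
  ; total      = refl }
⊗^-balanced {K = K} bK (suc k) = ⊗-balanced K (K ⊗^ k) bK (⊗^-balanced bK k)

∣rowSum-⊗^∣≤ : ∀ {n} {K : SignMatrix n} {r} → (∀ i → ℤ.∣ rowSum K i ∣ ℕ.≤ r) →
               ∀ k i → ℤ.∣ rowSum (K ⊗^ k) i ∣ ℕ.≤ r ℕ.^ k
∣rowSum-⊗^∣≤ h≤r zero    zero = ℕ.≤-refl
∣rowSum-⊗^∣≤ {n} {K} {r} h≤r (suc k) i = begin
  ℤ.∣ rowSum (K ⊗ (K ⊗^ k)) i ∣
    ≡⟨ cong ℤ.∣_∣ (rowSum-⊗ K (K ⊗^ k) i) ⟩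
  ℤ.∣ rowSum K i₁ ℤ.* rowSum (K ⊗^ k) i₂ ∣
    ≡⟨ ℤ.abs-* (rowSum K i₁) (rowSum (K ⊗^ k) i₂) ⟩
  ℤ.∣ rowSum K i₁ ∣ ℕ.* ℤ.∣ rowSum (K ⊗^ k) i₂ ∣
    ≤⟨ ℕ.*-mono-≤ (h≤r i₁) (∣rowSum-⊗^∣≤ {K = K} h≤r k i₂) ⟩
  r ℕ.* r ℕ.^ k ∎
  where
  open ℕ.≤-Reasoning
  i₁ = quotient (n ℕ.^ k) i
  i₂ = remainder {n} (n ℕ.^ k) i

i≤+∣i∣ : ∀ i → i ℤ.≤ ℤ.+ ℤ.∣ i ∣
i≤+∣i∣ (ℤ.+ _)     = ℤ.≤-refl
i≤+∣i∣ ℤ.-[1+ _ ]  = ℤ.-≤+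

-- Equivalent to `2 < 2^k`. At `k = 1` there is equality, hence exponents of the form `suc (suc j)`.
8ᵏ+8ᵏ<16ᵏ : ∀ j → let k = suc (suc j) in 8 ℕ.^ k ℕ.+ 8 ℕ.^ k ℕ.< 16 ℕ.^ k
8ᵏ+8ᵏ<16ᵏ j = begin-strict
  8 ℕ.* (8 ℕ.* E) ℕ.+ 8 ℕ.* (8 ℕ.* E)
    ≡⟨ solve 1 (λ e → con 8 :* (con 8 :* e) :+ con 8 :* (con 8 :* e) := con 128 :* e) refl E ⟩
  128 ℕ.* E            ≤⟨ ℕ.*-monoʳ-≤ 128 (ℕ.^-monoˡ-≤ j (ℕ.m≤m+n 8 8)) ⟩
  128 ℕ.* S            <⟨ ℕ.*-monoˡ-< S {{ℕ.m^n≢0 16 j}} (ℕ.m<m+n 128 {128} ℕ.z<s) ⟩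
  256 ℕ.* S            ≡⟨ ℕ.*-assoc 16 16 S ⟩
  16 ℕ.* (16 ℕ.* S)    ∎
  where
  open ℕ.≤-Reasoning
  open ℕ-Solver
  E = 8 ℕ.^ j
  S = 16 ℕ.^ j

rowSums<16ᵏ : ∀ j → let k = suc (suc j) in
  ∀ i i′ → rowSum (base ⊗^ k) i ℤ.+ rowSum (base ⊗^ k) i′ ℤ.< ℤ.+ (16 ℕ.^ k)
rowSums<16ᵏ j i i′ = ℤ.≤-<-trans (i≤+∣i∣ (h i ℤ.+ h i′)) (ℤ.+<+ (begin-strict
  ℤ.∣ h i ℤ.+ h i′ ∣               ≤⟨ ℤ.∣i+j∣≤∣i∣+∣j∣ (h i) (h i′) ⟩
  ℤ.∣ h i ∣ ℕ.+ ℤ.∣ h i′ ∣         ≤⟨ ℕ.+-mono-≤ (h≤ i) (h≤ i′) ⟩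
  8 ℕ.^ k ℕ.+ 8 ℕ.^ k              <⟨ 8ᵏ+8ᵏ<16ᵏ j ⟩
  16 ℕ.^ k                         ∎))
  where
  open ℕ.≤-Reasoning
  k = suc (suc j)
  h = rowSum (base ⊗^ k)
  h≤ = ∣rowSum-⊗^∣≤ {K = base} ∣rowSum-base∣≤8 k

-- The coordinates are `j` times `0F`, where `base` has row sum 8, followed by `4F`, where it has
-- row sum 4. The product of these row sums is `4^k 2^j`.
vertex : ∀ k → Fin (suc k) → Fin (16 ℕ.^ k)
vertex zero    _       = zero
vertex (suc k) zero    = combine {16} 4F (vertex k zero)
vertex (suc k) (suc j) = combine {16} 0F (vertex k j)

rowSum-vertex : ∀ k j → rowSum (base ⊗^ k) (vertex k j) ≡ ℤ.+ (4 ℕ.^ k ℕ.* 2 ℕ.^ toℕ j)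
rowSum-vertex zero    zero    = refl
rowSum-vertex (suc k) zero    = trans (rowSum-⊗-combine base (base ⊗^ k) 4F (vertex k zero))
  (trans (cong (ℤ.+ 4 ℤ.*_) (rowSum-vertex k zero))
  (trans (sym (ℤ.pos-* 4 (4 ℕ.^ k ℕ.* 1))) (cong ℤ.+_ (sym (ℕ.*-assoc 4 (4 ℕ.^ k) 1)))))
rowSum-vertex (suc k) (suc j) = trans (rowSum-⊗-combine base (base ⊗^ k) 0F (vertex k j))
  (trans (cong (ℤ.+ 8 ℤ.*_) (rowSum-vertex k j))
  (trans (sym (ℤ.pos-* 8 (4 ℕ.^ k ℕ.* 2 ℕ.^ toℕ j))) (cong ℤ.+_
    (solve 2 (λ x y → con 8 :* (x :* y) := con 4 :* x :* (con 2 :* y))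
         refl (4 ℕ.^ k) (2 ℕ.^ toℕ j)))))
  where open ℕ-Solver

^-injective : ∀ m → 1 ℕ.< m → ∀ {i j} → m ℕ.^ i ≡ m ℕ.^ j → i ≡ j
^-injective m 1<m {i} {j} eq = ℕ.≤-antisym (cancel (ℕ.≤-reflexive eq)) (cancel (ℕ.≤-reflexive (sym eq)))
  where
  cancel : ∀ {i j} → m ℕ.^ i ℕ.≤ m ℕ.^ j → i ℕ.≤ j
  cancel mⁱ≤mʲ = ℕ.≮⇒≥ λ j<i → ℕ.≤⇒≯ mⁱ≤mʲ (ℕ.^-monoʳ-< m 1<m j<i)

rowSum-vertex-injective : ∀ k → Injective _≡_ _≡_ (rowSum (base ⊗^ k) ∘ vertex k)
rowSum-vertex-injective k {i} {j} eq = Fin.toℕ-injective (^-injective 2 (ℕ.s≤s (ℕ.s≤s ℕ.z≤n))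
  (ℕ.*-cancelˡ-≡ _ _ (4 ℕ.^ k) {{ℕ.m^n≢0 4 k}}
    (ℤ.+-injective (trans (sym (rowSum-vertex k i)) (trans eq (rowSum-vertex k j))))))

4ⁱ*4ⁱ≡16ⁱ : ∀ i → 4 ℕ.^ i ℕ.* 4 ℕ.^ i ≡ 16 ℕ.^ i
4ⁱ*4ⁱ≡16ⁱ i = begin
  4 ℕ.^ i ℕ.* 4 ℕ.^ i   ≡⟨ ℕ.^-distribˡ-+-* 4 i i ⟨
  4 ℕ.^ (i ℕ.+ i)       ≡⟨ cong (λ k → 4 ℕ.^ (i ℕ.+ k)) (ℕ.+-identityʳ i) ⟨
  4 ℕ.^ (2 ℕ.* i)       ≡⟨ ℕ.^-*-assoc 4 2 i ⟨
  16 ℕ.^ i              ∎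
  where open ≡-Reasoning

-- The graphs of the theorem.

module Example (j : ℕ) where

  k : ℕ
  k = suc (suc j)

  K : SignMatrix (16 ℕ.^ k)
  K = base ⊗^ k

  open BalancedProperties K (⊗^-balanced base-balanced k) public

  a b : Fin (16 ℕ.^ k)
  a = vertex k 0F
  -- Row `7F` of `base` also has sum 4, so changing only the first coordinate of `a` from `4F` to
  -- `7F` keeps the row sum.
  b = combine {16} 7F (vertex (suc j) 0F)

  a≢b : a ≢ b
  a≢b a≡b with Fin.combine-injectiveˡ {16} 4F (vertex (suc j) 0F) 7F (vertex (suc j) 0F) a≡b
  ... | ()

  ha≡hb : rowSum K a ≡ rowSum K b
  ha≡hb = trans (rowSum-⊗-combine base (base ⊗^ suc j) 4F (vertex (suc j) 0F))
    (sym (rowSum-⊗-combine base (base ⊗^ suc j) 7F (vertex (suc j) 0F)))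

  ha≢0 : rowSum K a ≢ 0ℤ
  ha≢0 ha≡0 = ℕ.≢-nonZero⁻¹ (4 ℕ.^ k) {{ℕ.m^n≢0 4 k}}
    (trans (sym (ℕ.*-identityʳ (4 ℕ.^ k))) (ℤ.+-injective (trans (sym (rowSum-vertex k 0F)) ha≡0)))

  p : ℕ
  -- Chosen so that `2 p = 4^k`, the square root of the order `16^k`.
  p = 2 ℕ.* 4 ℕ.^ suc j

  1<p : 1 ℕ.< p
  1<p = ℕ.*-monoʳ-≤ 2 (ℕ.m^n>0 4 (suc j))

  4p²≡16ᵏ : (ℤ.+ p ℤ.+ ℤ.+ p) ℤ.* (ℤ.+ p ℤ.+ ℤ.+ p) ≡ ℤ.+ (16 ℕ.^ k)
  4p²≡16ᵏ = trans (sym (ℤ.pos-* (p ℕ.+ p) (p ℕ.+ p))) (cong ℤ.+_ (trans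
    (solve 1 (λ F → (con 2 :* F :+ con 2 :* F) :* (con 2 :* F :+ con 2 :* F) := con 16 :* (F :* F))
         refl (4 ℕ.^ suc j))
    (cong (16 ℕ.*_) (4ⁱ*4ⁱ≡16ⁱ (suc j)))))
    where open ℕ-Solver

  open FourEigenvalues K (⊗^-balanced base-balanced k) p 1<p 4p²≡16ᵏ (rowSums<16ᵏ j) a b a≢b ha≡hb ha≢0 public
    using (fourEigenvalues)

theorem9 : (t : ℤ) → Σ[ G ∈ Graph ]
    ( Graph.Connected G
    × ¬ (Graph.Bipartite G)
    × HasExactlyDistinctEigenvalues 4 (Graph.adjacencyMatrix G)
    × t ≤ + (length (Graph.distinctValencies G)))
theorem9 t =
    G
  , connected (rowSums<16ᵏ ℤ.∣ t ∣) a
  , not-bipartite (rowSums<16ᵏ ℤ.∣ t ∣) a b a≢b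
  , fourEigenvalues
  -- The exponent is `k = ∣ t ∣ + 2`, and `vertex k` supplies `k + 1 = ∣ t ∣ + 3` vertices with
  -- distinct row sums.
  , ℤ.≤-trans (i≤+∣i∣ t) (ℤ.+≤+ (ℕ.≤-trans (ℕ.m≤n+m ℤ.∣ t ∣ 3)
      (length-distinctValencies (vertex k) (rowSum-vertex-injective k))))
  where open Example ℤ.∣ t ∣
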